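{- Let $q\in\{2,3\}$, and put $d_2=6$, $d_3=2$. There exists a finite set $E_q$ of pairs of polynomials in $\mathbb{F}_q[T]$ with the following property: whenever $F,G\in\mathbb{F}_q[T]$ are nonzero monic polynomials with $\varphi(F)=\sigma(G)$, there exist an integer $n\ge 0$ and factorizations $F=\prod_{i=0}^n F_i$, $G=\prod_{i=0}^n G_i$ into monic polynomials with $\gcd(F_i,F_j)=\gcd(G_i,G_j)=1$ for $i\neq j$, such that $(F_0,G_0)\in E_q$ and, for each $1\le i\le n$, $(F_i,G_i)\in V_q(\mathbf{v}_i)$ for some tuple $\mathbf{v}_i=(v_{i,0},v_{i,1},\dots,v_{i,n_i})$ of positive integers with $v_{i,0}\mid d_q$ (i.e. $v_{i,0}\mid 6$ if $q=2$ and $v_{i,0}\mid 2$ if $q=3$).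
   Context: For a nonzero $A\in\mathbb{F}_q[T]$ let $|A|=q^{\deg A}$. A "prime" means a monic irreducible polynomial, and $v_P(F)$ is the exponent of the prime $P$ in $F$. For nonzero $F$, $\varphi(F)=\prod_{P\mid F}|P|^{v_P(F)-1}(|P|-1)$ (product over primes dividing $F$) and $\sigma(G)=\sum_{D\mid G}|D|$ (sum over monic divisors of $G$). For a tuple $\mathbf{v}=(v_0,v_1,\dots,v_m)$ of positive integers ($m\ge 0$), $V_q(\mathbf{v})$ is the set of pairs $(F,G)$ with $G=\prod_{k=1}^m P_k^{v_k}$ and $F=P_{m+1}$, where $P_1,\dots,P_{m+1}$ are primes with $\deg(P_k)=v_0\prod_{j=1}^{k-1}(v_j+1)$ for $k=1,\dots,m+1$. -}

module Defs where

open import Data.Bool using (Bool; true; false; _∧_; not)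
open import Data.Nat using (ℕ; zero; suc; _+_; _*_; _∸_; _^_; _≤_; _<_; _≤ᵇ_; _<ᵇ_; _≡ᵇ_)
open import Data.Nat.DivMod using (_mod_)
open import Data.Nat.Divisibility using (_∣_)
open import Data.Fin using (Fin; toℕ)
open import Data.Fin.Properties using () renaming (_≟_ to _≟F_)
open import Data.Vec using (Vec; []; _∷_; toList)
open import Data.List using (List; []; _∷_; map; concatMap; foldr; filterᵇ; _++_; [_]; zipWith; allFin; upTo; length)
open import Data.Bool.ListAction using (any)
open import Data.Nat.ListAction using (sum; product)
open import Data.List.Relation.Unary.All using (All)
open import Data.List.Relation.Binary.Pointwise using (Pointwise)
open import Data.Product using (Σ; _,_; proj₁; proj₂; _×_)
open import Data.Sum using (_⊎_)
open import Relation.Binary.PropositionalEquality using (_≡_)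
open import Relation.Nullary.Decidable using (⌊_⌋)

data Qs : Set where
  q2 q3 : Qs

-- q = card Q, written as suc (...) so that NonZero is automatic
cardP : Qs → ℕ
cardP q2 = 1
cardP q3 = 2

card : Qs → ℕ
card Q = suc (cardP Q)

dq : Qs → ℕ
dq q2 = 6
dq q3 = 2

module Poly (Q : Qs) where

  q : ℕ
  q = suc (cardP Q)

  F : Set
  F = Fin q

  _+F_ : F → F → F
  a +F b = (toℕ a + toℕ b) mod q

  _*F_ : F → F → F
  a *F b = (toℕ a * toℕ b) mod q

  0F 1F : F
  0F = 0 mod q
  1F = 1 mod q

  -- general polynomials as coefficient lists (constant term first)
  addL : List F → List F → List F
  addL [] ys = ys
  addL (x ∷ xs) [] = x ∷ xs
  addL (x ∷ xs) (y ∷ ys) = (x +F y) ∷ addL xs ys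

  mulL : List F → List F → List F
  mulL [] ys = []
  mulL (x ∷ xs) ys = addL (map (x *F_) ys) (0F ∷ mulL xs ys)

  -- A monic polynomial of degree n: T^n + c_{n-1} T^{n-1} + ... + c_0,
  -- stored as (n , [c_0 , ... , c_{n-1}]).  This is a canonical representation.
  Monic : Set
  Monic = Σ ℕ (Vec F)

  deg : Monic → ℕ
  deg = proj₁

  full : Monic → List F
  full (n , c) = toList c ++ [ 1F ]

  takeV : (k : ℕ) → List F → Vec F k
  takeV zero _ = []
  takeV (suc k) [] = 0F ∷ takeV k []
  takeV (suc k) (x ∷ xs) = x ∷ takeV k xs

  -- product of monic polynomials (the leading coefficient of the product is 1)
  _*M_ : Monic → Monic → Monic
  A *M B = (deg A + deg B , takeV (deg A + deg B) (mulL (full A) (full B)))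

  oneM : Monic
  oneM = (0 , [])

  prodM : List Monic → Monic
  prodM = foldr _*M_ oneM

  powM : Monic → ℕ → Monic
  powM P zero = oneM
  powM P (suc k) = P *M powM P k

  ∣_∣ : Monic → ℕ
  ∣ A ∣ = q ^ deg A

  _∣M_ : Monic → Monic → Set
  D ∣M G = Σ Monic λ H → D *M H ≡ G

  IsPrime : Monic → Set
  IsPrime P = 1 ≤ deg P × ((D : Monic) → D ∣M P → D ≡ oneM ⊎ D ≡ P)

  Coprime : Monic → Monic → Set
  Coprime A B = (D : Monic) → D ∣M A → D ∣M B → D ≡ oneM

  eqL : List F → List F → Bool
  eqL [] [] = true
  eqL [] (_ ∷ _) = false
  eqL (_ ∷ _) [] = false
  eqL (x ∷ xs) (y ∷ ys) = ⌊ x ≟F y ⌋ ∧ eqL xs ys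

  eqM : Monic → Monic → Bool
  eqM A B = eqL (full A) (full B)

  vecsOf : (k : ℕ) → List (Vec F k)
  vecsOf zero = [ [] ]
  vecsOf (suc k) = concatMap (λ a → map (a ∷_) (vecsOf k)) (allFin q)

  monicsOfDeg : ℕ → List Monic
  monicsOfDeg k = map (k ,_) (vecsOf k)

  monicsUpTo : ℕ → List Monic
  monicsUpTo n = concatMap monicsOfDeg (upTo (suc n))

  divB : Monic → Monic → Bool
  divB D G = (deg D ≤ᵇ deg G) ∧ any (λ H → eqM (D *M H) G) (monicsOfDeg (deg G ∸ deg D))

  primeB : Monic → Bool
  primeB P = (1 ≤ᵇ deg P) ∧ not (any (λ D → (1 ≤ᵇ deg D) ∧ ((deg D <ᵇ deg P) ∧ divB D P)) (monicsUpTo (deg P)))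

  val : Monic → Monic → ℕ
  val P G = length (filterᵇ (λ k → divB (powM P k) G) (map suc (upTo (deg G))))

  σ : Monic → ℕ
  σ G = sum (map ∣_∣ (filterᵇ (λ D → divB D G) (monicsUpTo (deg G))))

  φ : Monic → ℕ
  φ G = product (map (λ P → (∣ P ∣ ^ (val P G ∸ 1)) * (∣ P ∣ ∸ 1))
                     (filterᵇ (λ P → primeB P ∧ divB P G) (monicsUpTo (deg G))))

  -- degs v0 [v1..vm] = [d_1 , ... , d_{m+1}],  d_k = v0 * Π_{j<k} (v_j + 1)
  degs : ℕ → List ℕ → List ℕ
  degs v0 [] = [ v0 ]
  degs v0 (v ∷ vs) = v0 ∷ degs (v0 * (v + 1)) vs

  -- (F , G) ∈ V_q(v0 , vs): G = Π_{k=1}^m P_k^{v_k}, F = P_{m+1},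
  -- with P_1..P_{m+1} primes, deg P_k = d_k, and all entries of v positive.
  InV : ℕ → List ℕ → Monic → Monic → Set
  InV v0 vs F G =
    All (0 <_) (v0 ∷ vs) ×
    Σ (List Monic) λ Ps →
      Pointwise (λ P d → IsPrime P × deg P ≡ d) (Ps ++ [ F ]) (degs v0 vs) ×
      G ≡ prodM (zipWith powM Ps vs)

  InSomeV : Monic → Monic → Set
  InSomeV F G = Σ ℕ λ v0 → Σ (List ℕ) λ vs → v0 ∣ dq Q × InV v0 vs F G

{-# OPTIONS --safe #-}
-- Since σ(G) is prime to q, the equation φ(F) = σ(G) forces F to be squarefree, and it becomes
--   ∏_{P ∣ F} (q^deg P - 1) · ∏_{P ∣ G} (q^deg P - 1) = ∏_{P ∣ G} (q^((v_P + 1) deg P) - 1).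
-- For n ∤ d_q Zsigmondy's theorem gives a prime z such that z ∣ q^m - 1 only if n ∣ m.  Take the prime power
-- P^v ∥ G with the largest t = (v + 1) deg P.  If t ∤ d_q, such a prime z for n = t shows that t is the first
-- degree of one of the chains built so far (initially the prime factors of F), and P is put in front of that
-- chain; if t ∣ d_q, then P^v is moved to G₀.  In the end every chain starts in a degree dividing d_q, F₀ = 1,
-- and G₀ has bounded degree.
--
-- Zsigmondy's theorem in bases 2 and 3: if q^n - 1 has no primitive prime divisor, then comparing valuations
-- with lifting-the-exponent shows that Φₙ(q) is at most the largest prime factor p of n, while crude estimates
-- give Φₙ(q) ≥ q^(φ(n) - 2^(ω(n) - 1)), which exceeds p up to finitely many n.
module Submission where

open import Defs
open import Algebra.Bundles using (CommutativeRing)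
open import Data.Bool using (Bool; true; false; _∧_; not; T)
open import Data.Bool.ListAction using (any)
open import Data.Bool.Properties using (T-∧; T-≡; T?)
open import Data.Empty using (⊥; ⊥-elim)
open import Data.Fin using (Fin; toℕ; fromℕ<)
open import Data.Fin.Properties using (pigeonhole; toℕ<n; toℕ-fromℕ<; all?) renaming (_≟_ to _≟F_)
open import Data.List using (List; []; _∷_; map; _++_; [_]; length; filter; filterᵇ; downFrom; upTo; allFin; concat; concatMap; zipWith)
open import Data.List.Properties using (map-++; map-∘; length-++; length-map; ++-identityʳ)
open import Data.List.Membership.Propositional using (_∈_; lose; find)
open import Data.List.Membership.Propositional.Properties
open import Data.List.Membership.Propositional.Properties.WithK using (unique∧set⇒bag)
open import Data.List.Relation.Binary.BagAndSetEquality using (∼bag⇒↭)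
import Data.List.Relation.Binary.Permutation.Propositional as Perm
open import Data.List.Relation.Binary.Permutation.Propositional using (_↭_; ↭-refl; ↭-sym; ↭-trans; ↭-prep; ↭⇒↭ₛ)
open import Data.List.Relation.Binary.Permutation.Propositional.Properties using (shift; shifts; map⁺; ∈-resp-↭; ↭-length; All-resp-↭; ++⁺ˡ; ++⁺ʳ)
open import Data.List.Relation.Binary.Pointwise using (Pointwise; []; _∷_)
open import Data.List.Relation.Unary.All using (All; []; _∷_)
import Data.List.Relation.Unary.All as All
import Data.List.Relation.Unary.All.Properties as All
open import Data.List.Relation.Unary.AllPairs using (AllPairs; []; _∷_)
import Data.List.Relation.Unary.AllPairs as AllPairs
import Data.List.Relation.Unary.AllPairs.Properties as AllPairs
open import Data.List.Relation.Unary.Any using (Any; here; there; any?)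
open import Data.List.Relation.Unary.Any.Properties using (any⁺; any⁻)
open import Data.List.Relation.Unary.Unique.Propositional using (Unique)
import Data.List.Relation.Unary.Unique.Propositional.Properties as Unique
open import Data.Nat using (ℕ; zero; suc; _+_; _*_; _∸_; _^_; _%_; _/_; _≤_; _<_; _>_; z≤n; s≤s; _≤?_; _<?_; _≤ᵇ_; _<ᵇ_; NonZero; >-nonZero; nonTrivial⇒n>1)
open import Data.Nat.Coprimality using (coprime⇒gcd≡1) renaming (Coprime to Coprimeℕ)
open import Data.Nat.DivMod using (_mod_; m≡m%n+[m/n]*n; m%n<n)
open import Data.Nat.Divisibility
open import Data.Nat.GCD using (gcd-greatest; c*gcd[m,n]≡gcd[cm,cn])
open import Data.Nat.Induction using (<-wellFounded)
open import Data.Nat.ListAction using (sum; product)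
open import Data.Nat.ListAction.Properties using (sum-++; sum-↭; product-↭; ∈⇒∣product)
open import Data.Nat.Primality
open import Data.Nat.Primality.Factorisation using (factorise; factorisationHasAllPrimeFactors)
open import Data.Nat.Properties
open import Data.Nat.Tactic.RingSolver using (solve-∀)
open import Data.Product using (Σ; ∃; ∃₂; _,_; proj₁; proj₂; _×_)
open import Data.Sum using (_⊎_; inj₁; inj₂; [_,_]′)
open import Data.Vec using (Vec; []; _∷_; toList)
open import Function.Base using (_∘_)
open import Function.Bundles using (Equivalence; mk⇔)
open import Induction.WellFounded using (Acc; acc)
open import Level using (0ℓ)
open import Relation.Binary using (IsEquivalence; Setoid; tri<; tri≈; tri>)
open import Relation.Binary.PropositionalEquality hiding ([_])
open import Relation.Nullary using (¬_; Dec; yes; no; contradiction)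
open import Relation.Nullary.Decidable using (_×-dec_; _→-dec_; ¬?; map′; ⌊_⌋; toWitness; fromWitness; from-yes; from-no)

-- Valuations and lifting the exponent

-- Primitive primes are missing only at n = 1 and n = 6 in base 2 and at n = 2 in base 3. All
-- divisors of `dq Q` are nevertheless set aside together, because they form a set closed under
-- taking divisors: a prime that divides q^m - 1 only for multiples m of some n not dividing `dq Q`
-- divides no q^m - 1 with m dividing `dq Q`. Hence the factors that were set aside can never supply
-- the prime that is being traced. Putting P^v in front of a chain that starts in degree t removes
-- q^t - 1 from both sides, and q^deg P - 1 becomes the factor of the new start. So the equation
-- keeps its form, with one prime power fewer, and the argument can be repeated. Zsigmondy's theorem
-- is needed twice in each such step, for t and for the start of the chain, since a primitive prime
-- of q^t - 1 alone shows only that t divides that start.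

prime⇒2≤ : ∀ {p} → Prime p → 2 ≤ p
prime⇒2≤ pr = nonTrivial⇒n>1 _ {{prime⇒nonTrivial pr}}

prime∤1 : ∀ {p} → Prime p → ¬ p ∣ 1
prime∤1 pr p∣1 with ∣1⇒≡1 p∣1
... | refl = ¬prime[1] pr

primeDivisor : ∀ n → 2 ≤ n → ∃ λ p → Prime p × p ∣ n
primeDivisor n@(suc _) 2≤n with factorise n
... | record { factors = [] ; isFactorisation = refl } = contradiction 2≤n λ { (s≤s ()) }
... | record { factors = p ∷ ps ; isFactorisation = eq ; factorsPrime = pr ∷ _ } =
  p , pr , subst (p ∣_) (sym eq) (m∣m*n (product ps))

prime-∣-prime : ∀ {p r} → Prime p → Prime r → p ∣ r → p ≡ r
prime-∣-prime pp pr p∣r with prime⇒irreducible pr p∣r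
... | inj₁ refl = contradiction pp ¬prime[1]
... | inj₂ eq = eq

prime-∣-^ : ∀ {p} → Prime p → ∀ x n → p ∣ x ^ n → p ∣ x
prime-∣-^ pp x zero p∣1 = ⊥-elim (prime∤1 pp p∣1)
prime-∣-^ pp x (suc n) d with euclidsLemma x (x ^ n) pp d
... | inj₁ h = h
... | inj₂ h = prime-∣-^ pp x n h

-- Multiplicity of z in x; the junk value at x = 0 is 0.
νᶠ : ℕ → ℕ → ℕ → ℕ
νᶠ zero    z x = 0
νᶠ (suc f) z x with z ∣? x
... | yes (divides k _) = suc (νᶠ f z k)
... | no  _             = 0

ν : ℕ → ℕ → ℕ
ν z x = νᶠ x z x

νᶠ-spec : ∀ f z x → 2 ≤ z → 1 ≤ x → x ≤ f → ∃ λ u → x ≡ z ^ νᶠ f z x * u × ¬ z ∣ u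
νᶠ-spec zero z x 2≤z 1≤x x≤f = contradiction (≤-trans 1≤x x≤f) λ ()
νᶠ-spec (suc f) z x 2≤z 1≤x x≤f with z ∣? x
... | no z∤x = x , sym (+-identityʳ x) , z∤x
... | yes (divides zero refl) = contradiction 1≤x λ ()
... | yes (divides k@(suc k′) eq) = u , eq′ , z∤u
  where
  k<x : k < x
  k<x = subst (k <_) (sym eq) (m<m*n k z 2≤z)
  ih = νᶠ-spec f z k 2≤z (s≤s z≤n) (≤-pred (≤-trans k<x x≤f))
  u = proj₁ ih
  z∤u = proj₂ (proj₂ ih)
  eq′ : x ≡ z * z ^ νᶠ f z k * u
  eq′ = begin
    x                      ≡⟨ eq ⟩
    k * z                  ≡⟨ *-comm k z ⟩
    z * k                  ≡⟨ cong (z *_) (proj₁ (proj₂ ih)) ⟩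
    z * (z ^ νᶠ f z k * u) ≡⟨ *-assoc z (z ^ νᶠ f z k) u ⟨
    z * z ^ νᶠ f z k * u   ∎
    where open ≡-Reasoning

ν-spec : ∀ z x → 2 ≤ z → 1 ≤ x → ∃ λ u → x ≡ z ^ ν z x * u × ¬ z ∣ u
ν-spec z x 2≤z 1≤x = νᶠ-spec x z x 2≤z 1≤x ≤-refl

exponent-unique : ∀ z k l u w → 2 ≤ z → ¬ z ∣ u → ¬ z ∣ w → z ^ k * u ≡ z ^ l * w → k ≡ l
exponent-unique z zero zero u w 2≤z z∤u z∤w eq = refl
exponent-unique z zero (suc l) u w 2≤z z∤u z∤w eq =
  contradiction (divides (z ^ l * w) (trans (trans (sym (+-identityʳ u)) eq) (trans (*-assoc z _ w) (*-comm z _)))) z∤u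
exponent-unique z (suc k) zero u w 2≤z z∤u z∤w eq =
  contradiction (divides (z ^ k * u) (trans (trans (sym (+-identityʳ w)) (sym eq)) (trans (*-assoc z _ u) (*-comm z _)))) z∤w
exponent-unique z@(suc _) (suc k) (suc l) u w 2≤z z∤u z∤w eq =
  cong suc (exponent-unique z k l u w 2≤z z∤u z∤w
    (*-cancelˡ-≡ _ _ z (trans (sym (*-assoc z (z ^ k) u)) (trans eq (*-assoc z (z ^ l) w)))))

ν-unique : ∀ z k u → 2 ≤ z → 1 ≤ u → ¬ z ∣ u → ν z (z ^ k * u) ≡ k
ν-unique z@(suc _) k u 2≤z 1≤u z∤u
  with w , eq , z∤w ← ν-spec z (z ^ k * u) 2≤z (*-mono-≤ (m^n>0 z k) 1≤u)
  = sym (exponent-unique z k _ u w 2≤z z∤u z∤w eq)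

∣⇒1≤ν : ∀ z x → 2 ≤ z → 1 ≤ x → z ∣ x → 1 ≤ ν z x
∣⇒1≤ν z x 2≤z 1≤x z∣x with ν z x | ν-spec z x 2≤z 1≤x
... | zero  | u , eq , z∤u = contradiction (subst (z ∣_) (trans eq (+-identityʳ u)) z∣x) z∤u
... | suc _ | _ = s≤s z≤n

∤⇒ν≡0 : ∀ z x → 2 ≤ z → 1 ≤ x → ¬ z ∣ x → ν z x ≡ 0
∤⇒ν≡0 z x 2≤z 1≤x z∤x = trans (cong (ν z) (sym (+-identityʳ x))) (ν-unique z 0 x 2≤z 1≤x z∤x)

1≤ν⇒∣ : ∀ z x → 2 ≤ z → 1 ≤ x → 1 ≤ ν z x → z ∣ x
1≤ν⇒∣ z x 2≤z 1≤x h with z ∣? x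
... | yes d = d
... | no nd = contradiction (subst (1 ≤_) (∤⇒ν≡0 z x 2≤z 1≤x nd) h) λ ()

1≤*⇒1≤ˡ : ∀ m n → 1 ≤ m * n → 1 ≤ m
1≤*⇒1≤ˡ (suc m) n h = s≤s z≤n

1≤*⇒1≤ʳ : ∀ m n → 1 ≤ m * n → 1 ≤ n
1≤*⇒1≤ʳ m n h = 1≤*⇒1≤ˡ n m (subst (1 ≤_) (*-comm m n) h)

ν-* : ∀ {z} → Prime z → ∀ x y → 1 ≤ x → 1 ≤ y → ν z (x * y) ≡ ν z x + ν z y
ν-* {z} pz x y 1≤x 1≤y
  with u , equ , z∤u ← ν-spec z x (prime⇒2≤ pz) 1≤x
  with w , eqw , z∤w ← ν-spec z y (prime⇒2≤ pz) 1≤y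
  = trans (cong (ν z) eq) (ν-unique z (k + l) (u * w) (prime⇒2≤ pz) 1≤uw
      (λ d → [ z∤u , z∤w ]′ (euclidsLemma u w pz d)))
  where
  k = ν z x
  l = ν z y
  eq : x * y ≡ z ^ (k + l) * (u * w)
  eq = begin
    x * y                           ≡⟨ cong₂ _*_ equ eqw ⟩
    z ^ k * u * (z ^ l * w)         ≡⟨ rearrange (z ^ k) u (z ^ l) w ⟩
    z ^ k * z ^ l * (u * w)         ≡⟨ cong (_* (u * w)) (^-distribˡ-+-* z k l) ⟨
    z ^ (k + l) * (u * w)           ∎
    where
    open ≡-Reasoning
    rearrange : ∀ a b c d → a * b * (c * d) ≡ a * c * (b * d)
    rearrange = solve-∀
  1≤uw : 1 ≤ u * w
  1≤uw = 1≤*⇒1≤ʳ (z ^ (k + l)) (u * w) (subst (1 ≤_) eq (*-mono-≤ 1≤x 1≤y))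

ν-self : ∀ {z} → Prime z → ν z z ≡ 1
ν-self {z} pz = trans (cong (ν z) (sym (trans (*-identityʳ (z * 1)) (*-identityʳ z))))
  (ν-unique z 1 1 (prime⇒2≤ pz) ≤-refl (prime∤1 pz))

ν-product : ∀ {z} → Prime z → (f : ℕ → ℕ) → ∀ ds → All (λ d → 1 ≤ f d) ds →
            1 ≤ product (map f ds) × ν z (product (map f ds)) ≡ sum (map (λ d → ν z (f d)) ds)
ν-product pz f [] [] = ≤-refl , ∤⇒ν≡0 _ 1 (prime⇒2≤ pz) ≤-refl (prime∤1 pz)
ν-product pz f (d ∷ ds) (h ∷ hs) with ν-product pz f ds hs
... | pos , eq = *-mono-≤ h pos , trans (ν-* pz (f d) _ h pos) (cong (ν _ (f d) +_) eq)

-- The prime factors of x can be peeled off y one at a time. This turns the local bounds at all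
-- primes into a bound on the size of a cyclotomic value.
ν-≤⇒≤ : ∀ x y → 1 ≤ x → 1 ≤ y → (∀ z → Prime z → ν z x ≤ ν z y) → x ≤ y
ν-≤⇒≤ x@(suc _) y 1≤x 1≤y h with factorise x
... | record { factors = ps ; isFactorisation = eq ; factorsPrime = all } =
  subst (_≤ y) (sym eq) (go ps y all 1≤y (subst (λ x → ∀ z → Prime z → ν z x ≤ ν z y) eq h))
  where
  go : ∀ ps y → All Prime ps → 1 ≤ y → (∀ z → Prime z → ν z (product ps) ≤ ν z y) → product ps ≤ y
  go [] y [] 1≤y h = 1≤y
  go (p ∷ ps) y (pp ∷ pps) 1≤y h with 1≤ν⇒∣ p y (prime⇒2≤ pp) 1≤y (≤-trans 1≤ν (h p pp))
    where
    1≤ν : 1 ≤ ν p (p * product ps)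
    1≤ν = ∣⇒1≤ν p _ (prime⇒2≤ pp) (productOfPrimes≥1 (pp ∷ pps)) (m∣m*n (product ps))
  ... | divides y′ refl = subst (p * product ps ≤_) (*-comm p y′) (*-monoʳ-≤ p (go ps y′ pps 1≤y′ h′))
    where
    1≤y′ = 1≤*⇒1≤ˡ y′ p 1≤y
    1≤p = <⇒≤ (prime⇒2≤ pp)
    h′ : ∀ z → Prime z → ν z (product ps) ≤ ν z y′
    h′ z pz = +-cancelˡ-≤ (ν z p) _ _ (subst₂ _≤_ (ν-* pz p _ 1≤p (productOfPrimes≥1 pps))
      (trans (ν-* pz y′ p 1≤y′ 1≤p) (+-comm (ν z y′) (ν z p))) (h z pz))

-- Geometric sums and lifting the exponent

geo : ℕ → ℕ → ℕ
geo X zero    = 0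
geo X (suc m) = 1 + X * geo X m

^-geo : ∀ y m → suc y ^ m ≡ 1 + y * geo (suc y) m
^-geo y zero = cong suc (sym (*-zeroʳ y))
^-geo y (suc m) = trans (cong (suc y *_) (^-geo y m)) (step y (geo (suc y) m))
  where
  step : ∀ y g → suc y * (1 + y * g) ≡ 1 + y * (1 + suc y * g)
  step = solve-∀

^-geo-∸ : ∀ X m → 1 ≤ X → X ^ m ∸ 1 ≡ (X ∸ 1) * geo X m
^-geo-∸ (suc y) m _ = cong (_∸ 1) (^-geo y m)

-- The binomial coefficient "m choose 2", defined without a division.
tri : ℕ → ℕ
tri zero    = 0
tri (suc m) = tri m + m

tri-double : ∀ m → 2 * tri m + m ≡ m * m
tri-double zero = refl
tri-double (suc m) = trans (step₁ (tri m) m) (trans (cong (_+ (2 * m + 1)) (tri-double m)) (step₂ m))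
  where
  step₁ : ∀ t m → 2 * (t + m) + suc m ≡ (2 * t + m) + (2 * m + 1)
  step₁ = solve-∀
  step₂ : ∀ m → m * m + (2 * m + 1) ≡ suc m * suc m
  step₂ = solve-∀

-- The binomial expansion of ((1 + y)^m - 1) / y. Modulo y it shows which primes can divide the sum,
-- modulo y² how often.
geo-expand : ∀ y m → ∃ λ w → geo (suc y) m ≡ m + y * tri m + y * y * w
geo-expand y zero = 0 , sym (expand₀ y)
  where
  expand₀ : ∀ y → 0 + y * 0 + y * y * 0 ≡ 0
  expand₀ = solve-∀
geo-expand y (suc m) with geo-expand y m
... | w , eq = w + tri m + y * w , trans (cong (λ g → 1 + suc y * g) eq) (step y m (tri m) w)
  where
  step : ∀ y m t w → 1 + suc y * (m + y * t + y * y * w) ≡ suc m + y * (t + m) + y * y * (w + t + y * w)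
  step = solve-∀

1≤geo : ∀ X m → 1 ≤ m → 1 ≤ geo X m
1≤geo X (suc m) _ = s≤s z≤n

∣-geo⇒∣ : ∀ z y m → z ∣ y → z ∣ geo (suc y) m → z ∣ m
∣-geo⇒∣ z y m z∣y h with geo-expand y m
... | w , eq = ∣m+n∣m⇒∣n {z} {y * (tri m + y * w)} {m} (subst (z ∣_) (trans eq (rearrange m y (tri m) w)) h) (∣m⇒∣m*n _ z∣y)
  where
  rearrange : ∀ m y t w → m + y * t + y * y * w ≡ y * (t + y * w) + m
  rearrange = solve-∀

-- For odd z the middle term y * tri z of the expansion is divisible by z², since z ∣ tri z.
²∤-geo : ∀ z y → Prime z → z ∣ y → (z ≡ 2 → 4 ∣ y) → ¬ z * z ∣ geo (suc y) z
²∤-geo z y pz z∣y h2 d with z ≟ 2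
-- For z = 2 the sum is y + 2, which is 2 modulo 4 as soon as 4 ∣ y.
... | yes refl = contradiction
        (∣m+n∣m⇒∣n {4} {y} {2} (subst (4 ∣_) (small y) d) (h2 refl)) (>⇒∤ (s≤s (s≤s (s≤s z≤n))))
  where
  small : ∀ y → 1 + suc y * (1 + suc y * 0) ≡ y + 2
  small = solve-∀
... | no z≢2 with geo-expand y z | z∣y
... | w , eq | divides k refl = <⇒≱ z<zz (∣⇒≤ {{prime⇒nonZero pz}} zz∣z)
  where
  z∣tri : z ∣ tri z
  z∣tri with euclidsLemma 2 (tri z) pz (∣m+n∣m⇒∣n {z} {z} {2 * tri z}
               (subst (z ∣_) (trans (sym (tri-double z)) (+-comm _ z)) (m∣m*n z)) ∣-refl)
  ... | inj₁ z∣2 = contradiction (prime-∣-prime pz prime[2] z∣2) z≢2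
  ... | inj₂ h = h
  zz∣z : z * z ∣ z
  zz∣z with z∣tri
  ... | divides t teq = ∣m+n∣m⇒∣n {z * z} {z * z * (k * t + k * k * w)} {z}
    (subst (z * z ∣_) (trans eq (trans (cong (λ T → z + k * z * T + k * z * (k * z) * w) teq) (rearrange z k t w))) d)
    (m∣m*n _)
    where
    rearrange : ∀ z k t w → z + k * z * (t * z) + k * z * (k * z) * w ≡ z * z * (k * t + k * k * w) + z
    rearrange = solve-∀
  z<zz : z < z * z
  z<zz = m<m*n z z {{prime⇒nonZero pz}} (prime⇒2≤ pz)

private
  ν-geo-split : ∀ {z} → Prime z → ∀ X m → 2 ≤ X → 1 ≤ m →
                ν z (X ^ m ∸ 1) ≡ ν z (X ∸ 1) + ν z (geo X m)
  ν-geo-split {z} pz X m 2≤X 1≤m = trans (cong (ν z) (^-geo-∸ X m (<⇒≤ 2≤X)))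
    (ν-* pz (X ∸ 1) (geo X m) (∸-monoˡ-≤ 1 2≤X) (1≤geo X m 1≤m))

lte-prime-≢ : ∀ {z r} → Prime z → Prime r → z ≢ r → ∀ X → 2 ≤ X → z ∣ X ∸ 1 →
              ν z (X ^ r ∸ 1) ≡ ν z (X ∸ 1)
lte-prime-≢ {z} {r} pz pr z≢r X@(suc y) 2≤X z∣ = trans (ν-geo-split pz X r 2≤X 1≤r)
  (trans (cong (ν z y +_) (∤⇒ν≡0 z _ (prime⇒2≤ pz) (1≤geo X r 1≤r)
     λ d → z≢r (prime-∣-prime pz pr (∣-geo⇒∣ z y r z∣ d)))) (+-identityʳ _))
  where 1≤r = <⇒≤ (prime⇒2≤ pr)

-- By `²∤-geo` the cofactor `geo X z` contributes at most one z. The condition at z = 2 excludes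
-- cases like X = 3, where passing from 2 to 8 gains two factors.
lte-prime-≡ : ∀ {z} → Prime z → ∀ X → 2 ≤ X → z ∣ X ∸ 1 → (z ≡ 2 → 4 ∣ X ∸ 1) →
              ν z (X ^ z ∸ 1) ≤ ν z (X ∸ 1) + 1
lte-prime-≡ {z} pz X@(suc y) 2≤X z∣ h2 = ≤-trans (≤-reflexive (ν-geo-split pz X z 2≤X 1≤z))
  (+-monoʳ-≤ (ν z y) ν≤1)
  where
  1≤z = <⇒≤ (prime⇒2≤ pz)
  ν≤1 : ν z (geo X z) ≤ 1
  ν≤1 with ν z (geo X z) | ν-spec z (geo X z) (prime⇒2≤ pz) (1≤geo X z 1≤z)
  ... | zero | _ = z≤n
  ... | suc zero | _ = ≤-refl
  ... | suc (suc k) | u , eq , _ = contradiction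
    (divides (z ^ k * u) (trans eq (rearrange z (z ^ k) u))) (²∤-geo z y pz z∣ h2)
    where
    rearrange : ∀ z w u → z * (z * w) * u ≡ w * u * (z * z)
    rearrange = solve-∀

-- Orders modulo primes

module _ (q : ℕ) (2≤q : 2 ≤ q) where

  private
    instance
      q≢0 : NonZero q
      q≢0 = >-nonZero (<⇒≤ 2≤q)

  1≤q^ : ∀ d → 1 ≤ q ^ d
  1≤q^ d = m^n>0 q d

  2≤q^ : ∀ d → 1 ≤ d → 2 ≤ q ^ d
  2≤q^ (suc d) _ = *-mono-≤ 2≤q (1≤q^ d)

  1≤q^∸1 : ∀ d → 1 ≤ d → 1 ≤ q ^ d ∸ 1
  1≤q^∸1 d 1≤d = ∸-monoˡ-≤ 1 (2≤q^ d 1≤d)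

  q^∸1-* : ∀ a k → q ^ (k * a) ∸ 1 ≡ (q ^ a ∸ 1) * geo (q ^ a) k
  q^∸1-* a k = trans (cong (_∸ 1) (trans (cong (q ^_) (*-comm k a)) (sym (^-*-assoc q a k)))) (^-geo-∸ (q ^ a) k (1≤q^ a))

  q^∸1-mono-∣ : ∀ {a b} → a ∣ b → q ^ a ∸ 1 ∣ q ^ b ∸ 1
  q^∸1-mono-∣ {a} (divides k refl) = subst (q ^ a ∸ 1 ∣_) (sym (q^∸1-* a k)) (m∣m*n _)

  q^∸1-+ : ∀ a b → q ^ (a + b) ∸ 1 ≡ q ^ b * (q ^ a ∸ 1) + (q ^ b ∸ 1)
  q^∸1-+ a b = begin
    q ^ (a + b) ∸ 1                      ≡⟨ cong (_∸ 1) (trans (^-distribˡ-+-* q a b) (*-comm (q ^ a) (q ^ b))) ⟩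
    q ^ b * q ^ a ∸ 1                    ≡⟨ cong (λ x → q ^ b * x ∸ 1) (sym (m∸n+n≡m (1≤q^ a))) ⟩
    q ^ b * (q ^ a ∸ 1 + 1) ∸ 1          ≡⟨ cong (_∸ 1) (trans (*-distribˡ-+ (q ^ b) (q ^ a ∸ 1) 1) (cong (q ^ b * (q ^ a ∸ 1) +_) (*-identityʳ (q ^ b)))) ⟩
    q ^ b * (q ^ a ∸ 1) + q ^ b ∸ 1      ≡⟨ +-∸-assoc _ (1≤q^ b) ⟩
    q ^ b * (q ^ a ∸ 1) + (q ^ b ∸ 1)    ∎
    where open ≡-Reasoning

  -- For prime z, this also serves as the statement that z is a primitive prime divisor of q^e - 1.
  IsOrder : ℕ → ℕ → Set
  IsOrder z e = 1 ≤ e × z ∣ q ^ e ∸ 1 × (∀ m → 1 ≤ m → z ∣ q ^ m ∸ 1 → e ≤ m)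

  order-∣ : ∀ {z e} → IsOrder z e → ∀ b → z ∣ q ^ b ∸ 1 → e ∣ b
  order-∣ {z} {e@(suc _)} (1≤e , z∣ , min) b h with b % e in eq
  ... | zero = m%n≡0⇒n∣m b e eq
  ... | suc r = contradiction (min (suc r) (s≤s z≤n) z∣r) (<⇒≱ (subst (_< e) eq (m%n<n b e)))
    where
    z∣r : z ∣ q ^ suc r ∸ 1
    z∣r = ∣m+n∣m⇒∣n (subst (z ∣_)
      (trans (cong (λ x → q ^ x ∸ 1) (trans (m≡m%n+[m/n]*n b e) (trans (cong (_+ b / e * e) eq) (+-comm (suc r) _))))
             (q^∸1-+ (b / e * e) (suc r))) h)
      (∣n⇒∣m*n (q ^ suc r) (∣-trans z∣ (q^∸1-mono-∣ (divides (b / e) refl))))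

  order-exists : ∀ z n → 1 ≤ n → z ∣ q ^ n ∸ 1 → ∃ (IsOrder z)
  order-exists z n 1≤n z∣ = go n n ≤-refl 1≤n z∣
    where
    go : ∀ f n → n ≤ f → 1 ≤ n → z ∣ q ^ n ∸ 1 → ∃ (IsOrder z)
    go zero n n≤f 1≤n z∣ = contradiction (≤-trans 1≤n n≤f) λ ()
    go (suc f) n n≤f 1≤n z∣ with anyUpTo? (λ m → (1 ≤? m) ×-dec (z ∣? q ^ m ∸ 1)) n
    ... | yes (m , m<n , 1≤m , h) = go f m (≤-pred (≤-trans m<n n≤f)) 1≤m h
    ... | no none = n , 1≤n , z∣ , λ m 1≤m h → ≮⇒≥ λ m<n → none (m , m<n , 1≤m , h)

  prime∣q^∸1⇒∤q : ∀ {z} → Prime z → ∀ n → 1 ≤ n → z ∣ q ^ n ∸ 1 → ¬ z ∣ q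
  prime∣q^∸1⇒∤q {z} pz n@(suc m) 1≤n z∣ z∣q = prime∤1 pz (∣m+n∣m⇒∣n {z} {q ^ n ∸ 1} {1}
    (subst (z ∣_) (sym (m∸n+n≡m (1≤q^ n))) (∣m⇒∣m*n (q ^ m) z∣q)) z∣)

  ^-agree⇒∣ : ∀ z .{{_ : NonZero z}} → Prime z → ¬ z ∣ q → ∀ i j → i < j → q ^ i % z ≡ q ^ j % z → z ∣ q ^ (j ∸ i) ∸ 1
  ^-agree⇒∣ z pz z∤q i j i<j same
    with euclidsLemma (q ^ i) (q ^ k ∸ 1) pz (subst (z ∣_) split z∣diff)
    where
    k = j ∸ i
    split : q ^ j ∸ q ^ i ≡ q ^ i * (q ^ k ∸ 1)
    split = trans (cong₂ _∸_ (trans (cong (q ^_) (sym (m+[n∸m]≡n (<⇒≤ i<j)))) (^-distribˡ-+-* q i k))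
                    (sym (*-identityʳ (q ^ i)))) (sym (*-distribˡ-∸ (q ^ i) (q ^ k) 1))
    %-agree : ∀ x y → x % z ≡ y % z → z ∣ y ∸ x
    %-agree x y eq = divides (y / z ∸ x / z) (begin
      y ∸ x                                     ≡⟨ cong₂ _∸_ (m≡m%n+[m/n]*n y z) (m≡m%n+[m/n]*n x z) ⟩
      (y % z + y / z * z) ∸ (x % z + x / z * z) ≡⟨ cong (λ r → (r + y / z * z) ∸ (x % z + x / z * z)) (sym eq) ⟩
      (x % z + y / z * z) ∸ (x % z + x / z * z) ≡⟨ [m+n]∸[m+o]≡n∸o (x % z) _ _ ⟩
      y / z * z ∸ x / z * z                     ≡⟨ *-distribʳ-∸ z (y / z) (x / z) ⟨
      (y / z ∸ x / z) * z                       ∎)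
      where open ≡-Reasoning
    z∣diff : z ∣ q ^ j ∸ q ^ i
    z∣diff = %-agree (q ^ i) (q ^ j) same
  ... | inj₁ h = contradiction (prime-∣-^ pz q i h) z∤q
  ... | inj₂ h = h

  private
    residue-pos : ∀ z .{{_ : NonZero z}} → Prime z → ¬ z ∣ q → ∀ i → 1 ≤ q ^ i % z
    residue-pos z pz z∤q i = n≢0⇒n>0 λ eq → z∤q (prime-∣-^ pz q i (m%n≡0⇒n∣m (q ^ i) z eq))

  -- A form of Fermat's little theorem: by pigeonhole two of q⁰, …, q^(z-1) agree modulo z.
  order<prime : ∀ {z e} → Prime z → ¬ z ∣ q → IsOrder z e → e < z
  order<prime {zero} pz = contradiction pz ¬prime[0]
  order<prime {z@(suc z′)} {e} pz z∤q (_ , _ , min) with pigeonhole {z′} {z} ≤-refl residue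
    where
    residue : Fin z → Fin z′
    -- No residue is 0, so lowering each by 1 places z powers into only z - 1 slots.
    residue i = fromℕ< {q ^ toℕ i % z ∸ 1} (∸-monoˡ-< (m%n<n (q ^ toℕ i) z) (residue-pos z pz z∤q (toℕ i)))
  ... | i , j , i<j , eq = ≤-<-trans
      (min (toℕ j ∸ toℕ i) (m<n⇒0<n∸m i<j) (^-agree⇒∣ z pz z∤q (toℕ i) (toℕ j) i<j
        (∸-cancelʳ-≡ (residue-pos z pz z∤q (toℕ i)) (residue-pos z pz z∤q (toℕ j)) (trans (sym (toℕ-fromℕ< _)) (trans (cong toℕ eq) (toℕ-fromℕ< _))))))
      (≤-<-trans (m∸n≤m (toℕ j) (toℕ i)) (toℕ<n j))

-- For n = a · ∏ rs with rs the prime divisors of n, these are the n / m with μ(m) = 1, resp. μ(m) = -1;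
-- the quotient of ∏ (q^d - 1) over evs by that over ods is thus the cyclotomic value Φₙ(q).
evs ods : List ℕ → ℕ → List ℕ
evs []       a = a ∷ []
evs (r ∷ rs) a = evs rs (r * a) ++ ods rs a
ods []       a = []
ods (r ∷ rs) a = ods rs (r * a) ++ evs rs a

sum-map-++ : ∀ (f : ℕ → ℕ) xs ys → sum (map f (xs ++ ys)) ≡ sum (map f xs) + sum (map f ys)
sum-map-++ f xs ys = trans (cong sum (map-++ f xs ys)) (sum-++ (map f xs) (map f ys))

prodPred : List ℕ → ℕ
prodPred rs = product (map (_∸ 1) rs)

-- This is ∑ μ(m) n / m = φ(n), with the negative terms moved to the other side; when `rs` are the
-- primes of n, the last summand is φ(n).
sum-evs : ∀ rs a → All (1 ≤_) rs → sum (evs rs a) ≡ sum (ods rs a) + a * prodPred rs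
sum-evs [] a [] = trans (+-identityʳ a) (sym (*-identityʳ a))
sum-evs (suc r ∷ rs) a (_ ∷ h) = begin
  sum (evs rs (suc r * a) ++ ods rs a)                         ≡⟨ sum-++ (evs rs (suc r * a)) _ ⟩
  sum (evs rs (suc r * a)) + sum (ods rs a)                    ≡⟨ cong (_+ sum (ods rs a)) (sum-evs rs (suc r * a) h) ⟩
  sum (ods rs (suc r * a)) + suc r * a * X + sum (ods rs a)    ≡⟨ rearrange (sum (ods rs (suc r * a))) (sum (ods rs a)) r a X ⟩
  sum (ods rs (suc r * a)) + (sum (ods rs a) + a * X) + a * (r * X) ≡⟨ cong (λ s → sum (ods rs (suc r * a)) + s + a * (r * X)) (sum-evs rs a h) ⟨
  sum (ods rs (suc r * a)) + sum (evs rs a) + a * (r * X)      ≡⟨ cong (_+ a * (r * X)) (sum-++ (ods rs (suc r * a)) _) ⟨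
  sum (ods rs (suc r * a) ++ evs rs a) + a * (r * X)           ∎
  where
  open ≡-Reasoning
  X = prodPred rs
  rearrange : ∀ A B r a X → A + suc r * a * X + B ≡ A + (B + a * X) + a * (r * X)
  rearrange = solve-∀

-- The cofactors a and b are independent because the recursion pairs lists built on `r * a` with
-- lists built on `a`.
length-evs-ods : ∀ rs a b → length (evs rs a) + length (ods rs b) ≡ 2 ^ length rs
length-evs-ods [] a b = refl
length-evs-ods (r ∷ rs) a b = begin
  length (evs rs (r * a) ++ ods rs a) + length (ods rs (r * b) ++ evs rs b) ≡⟨ cong₂ _+_ (length-++ (evs rs (r * a))) (length-++ (ods rs (r * b))) ⟩
  length (evs rs (r * a)) + length (ods rs a) + (length (ods rs (r * b)) + length (evs rs b)) ≡⟨ cong₂ _+_ (length-evs-ods rs (r * a) a) (trans (+-comm (length (ods rs (r * b))) _) (length-evs-ods rs b (r * b))) ⟩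
  2 ^ length rs + 2 ^ length rs ≡⟨ cong (2 ^ length rs +_) (+-identityʳ _) ⟨
  2 ^ length rs + (2 ^ length rs + 0) ∎
  where open ≡-Reasoning

length-evs-∷ : ∀ r rs a → length (evs (r ∷ rs) a) ≡ 2 ^ length rs
length-evs-∷ r rs a = trans (length-++ (evs rs (r * a))) (length-evs-ods rs (r * a) a)

evs-multiple : ∀ rs a → All (a ∣_) (evs rs a)
ods-multiple : ∀ rs a → All (a ∣_) (ods rs a)
evs-multiple [] a = ∣-refl ∷ []
evs-multiple (r ∷ rs) a = All.++⁺ (All.map (∣-trans (n∣m*n r)) (evs-multiple rs (r * a))) (ods-multiple rs a)
ods-multiple [] a = []
ods-multiple (r ∷ rs) a = All.++⁺ (All.map (∣-trans (n∣m*n r)) (ods-multiple rs (r * a))) (evs-multiple rs a)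

private
  cong-evs : ∀ (f : ℕ → ℕ) rs c a → (∀ d → a ∣ d → f (c * d) ≡ f d) →
             sum (map f (evs rs (c * a))) ≡ sum (map f (evs rs a)) ×
             sum (map f (ods rs (c * a))) ≡ sum (map f (ods rs a))
  cong-evs f [] c a h = cong (_+ 0) (h a ∣-refl) , refl
  cong-evs f (r ∷ rs) c a h
    with e₁ , o₁ ← cong-evs f rs c (r * a) (λ d ra∣d → h d (∣-trans (n∣m*n r) ra∣d))
    with e₂ , o₂ ← cong-evs f rs c a h
    rewrite trans (sym (*-assoc r c a)) (trans (cong (_* a) (*-comm r c)) (*-assoc c r a))
    = trans (sum-map-++ f (evs rs (c * (r * a))) _) (trans (cong₂ _+_ e₁ o₂) (sym (sum-map-++ f (evs rs (r * a)) _)))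
    , trans (sum-map-++ f (ods rs (c * (r * a))) _) (trans (cong₂ _+_ o₁ e₂) (sym (sum-map-++ f (ods rs (r * a)) _)))

-- The entries n / m and n / (r m), for m not divisible by r, have opposite signs, and f does not
-- distinguish them.
evs-ods-cancel : ∀ (f : ℕ → ℕ) {r} rs a → r ∈ rs → (∀ d → a ∣ d → f (r * d) ≡ f d) →
                 sum (map f (evs rs a)) ≡ sum (map f (ods rs a))
evs-ods-cancel f (r ∷ rs) a (here refl) h with cong-evs f rs r a h
... | e , o = trans (sum-map-++ f (evs rs (r * a)) _) (trans (cong₂ _+_ e (sym o))
   (trans (+-comm (sum (map f (evs rs a))) _) (sym (sum-map-++ f (ods rs (r * a)) _))))
evs-ods-cancel f (s ∷ rs) a (there r∈) h =
  trans (sum-map-++ f (evs rs (s * a)) _) (trans (cong₂ _+_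
     (evs-ods-cancel f rs (s * a) r∈ (λ d sa∣d → h d (∣-trans (n∣m*n s) sa∣d)))
     (sym (evs-ods-cancel f rs a r∈ h))) (sym (sum-map-++ f (ods rs (s * a)) _)))

Deficient : List ℕ → ℕ → ℕ → Set
Deficient rs n d = ∃ λ r → r ∈ rs × r * d ∣ n

private
  lift-deficient : ∀ {rs n m s} → n ∣ m → ∀ {d} → Deficient rs n d → Deficient (s ∷ rs) m d
  lift-deficient n∣m (r , r∈ , h) = r , there r∈ , ∣-trans h n∣m

-- Only m = 1 yields n itself; any other m contains some r of `rs`, and then r times n / m still
-- divides n. This isolates the one term that matters in `local-bound`.
evs-top : ∀ rs a → ∃ λ ds → evs rs a ≡ product rs * a ∷ ds × All (Deficient rs (product rs * a)) ds
ods-deficient : ∀ rs a → All (Deficient rs (product rs * a)) (ods rs a)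
evs-top [] a = [] , cong (_∷ []) (sym (+-identityʳ a)) , []
evs-top (r ∷ rs) a with evs-top rs (r * a)
... | ds , eq , all = ds ++ ods rs a , trans (cong (_++ ods rs a) eq) (cong (_∷ (ds ++ ods rs a)) top≡) ,
  All.++⁺ (All.map (lift-deficient (∣-reflexive top≡)) all) (All.map (lift-deficient below) (ods-deficient rs a))
  where
  top≡ : product rs * (r * a) ≡ r * product rs * a
  top≡ = trans (sym (*-assoc (product rs) r a)) (cong (_* a) (*-comm (product rs) r))
  below : product rs * a ∣ r * product rs * a
  below = *-monoˡ-∣ a (n∣m*n r)
ods-deficient [] a = []
ods-deficient (r ∷ rs) a with evs-top rs a
... | ds , eq , all = All.++⁺ (All.map (lift-deficient (∣-reflexive top≡)) (ods-deficient rs (r * a)))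
    (subst (All _) (sym eq) ((r , here refl , ∣-reflexive (sym (*-assoc r (product rs) a))) ∷ All.map (lift-deficient below) all))
  where
  top≡ : product rs * (r * a) ≡ r * product rs * a
  top≡ = trans (sym (*-assoc (product rs) r a)) (cong (_* a) (*-comm (product rs) r))
  below : product rs * a ∣ r * product rs * a
  below = *-monoˡ-∣ a (n∣m*n r)

-- Zsigmondy's theorem in bases 2 and 3

record Radical (n : ℕ) : Set where
  field
    primes   : List ℕ
    cofactor : ℕ
    isPrime  : All Prime primes
    sorted   : AllPairs _>_ primes
    complete : ∀ {p} → Prime p → p ∣ n → p ∈ primes
    eq       : n ≡ product primes * cofactor

distinctPrimes-∣ : ∀ {n} rs → All Prime rs → AllPairs _>_ rs → All (_∣ n) rs → product rs ∣ n
distinctPrimes-∣ [] [] [] [] = 1∣ _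
distinctPrimes-∣ {n} (r ∷ rs) (pr ∷ prs) (r> ∷ s) (r∣n ∷ d) with distinctPrimes-∣ rs prs s d
... | divides m refl with euclidsLemma m (product rs) pr r∣n
...   | inj₁ r∣m = *-pres-∣ r∣m (∣-refl {product rs})
...   | inj₂ r∣Π = contradiction (All.lookup r> (factorisationHasAllPrimeFactors pr r∣Π prs)) (<-irrefl refl)

radical : ∀ n → 1 ≤ n → Radical n
radical n@(suc _) 1≤n = record
  { primes = rs ; cofactor = quotient Π∣n ; isPrime = prs ; sorted = st ; complete = comp
  ; eq = trans (_∣_.equality Π∣n) (*-comm (quotient Π∣n) (product rs)) }
  where
  P? = λ p → prime? p ×-dec (p ∣? n)
  rs = filter P? (downFrom (suc n))
  all = All.all-filter P? (downFrom (suc n))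
  prs = All.map proj₁ all
  st = AllPairs.filter⁺ P? (AllPairs.applyDownFrom⁺₁ (λ i → i) (suc n) (λ j<i _ → j<i))
  comp : ∀ {p} → Prime p → p ∣ n → p ∈ rs
  comp pp p∣n = ∈-filter⁺ P? (∈-downFrom⁺ (s≤s (∣⇒≤ p∣n))) (pp , p∣n)
  Π∣n = distinctPrimes-∣ rs prs st (All.map proj₂ all)

squarefree-split : ∀ {r} rs → All Prime rs → AllPairs _>_ rs → r ∈ rs → ∃ λ R → product rs ≡ r * R × ¬ r ∣ R
squarefree-split (r ∷ rs) (pr ∷ prs) (r> ∷ s) (here refl) = product rs , refl ,
  λ r∣Π → <-irrefl refl (All.lookup r> (factorisationHasAllPrimeFactors pr r∣Π prs))
squarefree-split {r} (t ∷ rs) (pt ∷ prs) (t> ∷ s) (there r∈) with squarefree-split rs prs s r∈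
... | R , eq , r∤R = t * R , trans (cong (t *_) eq) (rearrange t r R) , λ d →
      [ (λ r∣t → <-irrefl (prime-∣-prime pr pt r∣t) (All.lookup t> r∈)) , r∤R ]′ (euclidsLemma t R pr d)
  where
  pr = All.lookup prs r∈
  rearrange : ∀ t r R → t * (r * R) ≡ r * (t * R)
  rearrange = solve-∀

-- Because gcd(d R, d r) = d gcd(R, r) = d.
∣-coprime-factors : ∀ {r} → Prime r → ∀ e d R → ¬ r ∣ R → e ∣ d * R → e ∣ d * r → e ∣ d
∣-coprime-factors {r} pr e d R r∤R h₁ h₂ = subst (e ∣_)
  (trans (sym (c*gcd[m,n]≡gcd[cm,cn] d R r)) (trans (cong (d *_) (coprime⇒gcd≡1 cop)) (*-identityʳ d)))
  (gcd-greatest h₁ h₂)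
  where
  cop : Coprimeℕ R r
  cop (i∣R , i∣r) with prime⇒irreducible pr i∣r
  ... | inj₁ i≡1 = i≡1
  ... | inj₂ refl = contradiction i∣R r∤R

quotient≥2 : ∀ {e n} k → n ≡ k * e → 1 ≤ n → e < n → 2 ≤ k
quotient≥2 zero n≡ke 1≤n e<n = contradiction (subst (1 ≤_) n≡ke 1≤n) λ ()
quotient≥2 {e} (suc zero) n≡ke 1≤n e<n = contradiction (subst (e <_) (trans n≡ke (+-identityʳ e)) e<n) (<-irrefl refl)
quotient≥2 (suc (suc _)) n≡ke 1≤n e<n = s≤s (s≤s z≤n)

≤-sum : ∀ {x xs} → x ∈ xs → x ≤ sum xs
≤-sum {xs = y ∷ ys} (here refl) = m≤m+n _ _
≤-sum {xs = y ∷ ys} (there x∈) = ≤-trans (≤-sum x∈) (m≤n+m _ y)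

sum-zeros : ∀ (f : ℕ → ℕ) ds → All (λ d → f d ≡ 0) ds → sum (map f ds) ≡ 0
sum-zeros f [] [] = refl
sum-zeros f (d ∷ ds) (h ∷ hs) = cong₂ _+_ h (sum-zeros f ds hs)

module _ (q : ℕ) (2≤q : 2 ≤ q) where

  NonPrimitive : ℕ → Set
  NonPrimitive n = ∀ z → Prime z → z ∣ q ^ n ∸ 1 → ∃ λ b → 1 ≤ b × b < n × z ∣ q ^ b ∸ 1

  module _ {n p rest a} (1≤n : 1 ≤ n) (prs : All Prime (p ∷ rest)) (sorted : AllPairs _>_ (p ∷ rest))
           (complete : ∀ {r} → Prime r → r ∣ n → r ∈ p ∷ rest)
           (n≡ : n ≡ product (p ∷ rest) * a)
           -- Here `product rest * a` is n / p; this supplies the condition of `lte-prime-≡` in the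
           -- case z = p = 2.
           (h4 : p ≡ 2 → 2 ∣ q ^ n ∸ 1 → 4 ∣ q ^ (product rest * a) ∸ 1)
           (nonPrim : NonPrimitive n)
    where

    private
      rs = p ∷ rest
      pp = All.head prs

      deficient-∣ : ∀ {d} → Deficient rs (product rs * a) d → d ∣ n
      deficient-∣ {d} (r , _ , h) = subst (d ∣_) (sym n≡) (∣-trans (n∣m*n r) h)

      evs-∣ : All (_∣ n) (evs rs a)
      evs-∣ with evs-top rs a
      ... | ds , eq , all = subst (All (_∣ n)) (sym eq) (∣-reflexive (sym n≡) ∷ All.map deficient-∣ all)

      positive : ∀ {d} → d ∣ n → 1 ≤ d
      positive {zero} d = contradiction (subst (1 ≤_) (0∣⇒≡0 d) 1≤n) λ ()
      positive {suc d} _ = s≤s z≤n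

    module _ {z} (pz : Prime z) where

      private
        2≤z = prime⇒2≤ pz

        ℓ : ℕ → ℕ
        ℓ d = ν z (q ^ d ∸ 1)

        ℓ≡0 : ∀ {d} → 1 ≤ d → ¬ z ∣ q ^ d ∸ 1 → ℓ d ≡ 0
        ℓ≡0 {d} 1≤d = ∤⇒ν≡0 z _ 2≤z (1≤q^∸1 q 2≤q d 1≤d)

      -- Let e be the order of q modulo z. If a prime r other than z divides n / e, the terms for d
      -- and r d cancel. Otherwise n / e is a power of z, and a nontrivial one since z is not
      -- primitive; then z must be p, the only even term left is the one for n, and lifting the
      -- exponent compares it with the odd term for n / p.
      local-bound : sum (map ℓ (evs rs a)) ≤ sum (map ℓ (ods rs a)) + ν z p
      local-bound with z ∣? q ^ n ∸ 1
      ... | no z∤ = ≤-trans (≤-reflexive (sum-zeros ℓ (evs rs a)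
              (All.map (λ d∣n → ℓ≡0 (positive d∣n) (λ h → z∤ (∣-trans h (q^∸1-mono-∣ q 2≤q d∣n)))) evs-∣))) z≤n
      ... | yes z∣ with order-exists q 2≤q z n 1≤n z∣
      ... | e , ord with any? (λ r → ¬? (r ≟ z) ×-dec (r * e ∣? n)) rs
      ... | yes found = ≤-trans (≤-reflexive (evs-ods-cancel ℓ rs a r∈ invariant)) (m≤m+n _ _)
        where
        r = proj₁ (find found)
        r∈ = proj₁ (proj₂ (find found))
        r≢z = proj₁ (proj₂ (proj₂ (find found)))
        re∣n = proj₂ (proj₂ (proj₂ (find found)))
        pr = All.lookup prs r∈
        split = squarefree-split rs prs sorted r∈
        R = proj₁ split
        e∣aR : e ∣ a * R
        e∣aR = *-cancelˡ-∣ r {{prime⇒nonZero pr}} (subst (r * e ∣_)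
          (trans n≡ (trans (cong (_* a) (proj₁ (proj₂ split))) (rearrange r R a))) re∣n)
          where
          rearrange : ∀ r R a → r * R * a ≡ r * (a * R)
          rearrange = solve-∀
        invariant : ∀ d → a ∣ d → ℓ (r * d) ≡ ℓ d
        invariant zero a∣d = cong ℓ (*-zeroʳ r)
        invariant d@(suc _) a∣d with z ∣? q ^ d ∸ 1
        ... | yes z∣d = trans (cong (λ x → ν z (x ∸ 1)) (trans (cong (q ^_) (*-comm r d)) (sym (^-*-assoc q d r))))
                (lte-prime-≢ pz pr (λ eq → r≢z (sym eq)) (q ^ d) (2≤q^ q 2≤q d (s≤s z≤n)) z∣d)
        -- If z divided q^(r d) - 1, then e ∣ d r; together with e ∣ d R, where r does not divide R,
        -- this gives e ∣ d, against `z∤d`.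
        ... | no z∤d = trans (ℓ≡0 (*-mono-≤ (<⇒≤ (prime⇒2≤ pr)) (s≤s z≤n))
                (λ h → z∤d (∣-trans (proj₁ (proj₂ ord)) (q^∸1-mono-∣ q 2≤q
                   (∣-coprime-factors pr e d R (proj₂ (proj₂ split))
                     (∣-trans e∣aR (*-monoˡ-∣ R a∣d))
                     (subst (e ∣_) (*-comm r d) (order-∣ q 2≤q ord (r * d) h)))))))
                (sym (ℓ≡0 {d} (s≤s z≤n) z∤d))
      ... | no none = bound z≡p
        where
        none′ : ∀ {r} → r ∈ rs → r ≢ z → ¬ r * e ∣ n
        none′ r∈ r≢z h = none (lose r∈ (r≢z , h))
        e∣n = order-∣ q 2≤q ord n z∣
        e<n : e < n
        e<n with nonPrim z pz z∣
        ... | b , 1≤b , b<n , h = ≤-<-trans (proj₂ (proj₂ ord) b 1≤b h) b<n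
        ze∣n : z * e ∣ n
        ze∣n with e∣n
        ... | divides k n≡ke with primeDivisor k (quotient≥2 k n≡ke 1≤n e<n)
        ... | r , pr , r∣k with r ≟ z
        ... | yes refl = subst (z * e ∣_) (sym n≡ke) (*-monoˡ-∣ e r∣k)
        ... | no r≢z = contradiction re∣n (none′ (complete pr (∣-trans (m∣m*n e) re∣n)) r≢z)
          where re∣n = subst (r * e ∣_) (sym n≡ke) (*-monoˡ-∣ e r∣k)
        z≤p : z ≤ p
        z≤p with complete pz (∣-trans (m∣m*n e) ze∣n)
        ... | here refl = ≤-refl
        ... | there z∈ = <⇒≤ (All.lookup (AllPairs.head sorted) z∈)
        p∣n : p ∣ n
        p∣n = subst (p ∣_) (trans (sym (*-assoc p (product rest) a)) (sym n≡)) (m∣m*n (product rest * a))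
        -- p ∣ n = e zʲ and p ≠ z force p ∣ e, which is impossible as e < z ≤ p.
        z≡p : z ≡ p
        z≡p with p ≟ z
        ... | yes eq = sym eq
        ... | no p≢z with e∣n
        ... | divides k n≡ke with euclidsLemma k e pp (subst (p ∣_) n≡ke p∣n)
        ... | inj₁ p∣k = contradiction (subst (p * e ∣_) (sym n≡ke) (*-monoˡ-∣ e p∣k)) (none′ (here refl) p≢z)
        ... | inj₂ p∣e = contradiction (≤-trans z≤p (∣⇒≤ {{>-nonZero (proj₁ ord)}} p∣e))
               (<⇒≱ (order<prime q 2≤q pz (prime∣q^∸1⇒∤q q 2≤q pz n 1≤n z∣) ord))
        n′ = product rest * a
        n≡pn′ : n ≡ n′ * p
        n≡pn′ = trans n≡ (trans (*-assoc p (product rest) a) (*-comm p n′))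
        bound : z ≡ p → sum (map ℓ (evs rs a)) ≤ sum (map ℓ (ods rs a)) + ν z p
        bound refl = begin
          sum (map ℓ (evs rs a))                 ≡⟨ evs-sum ⟩
          ℓ n                                    ≡⟨ cong (λ x → ν z (x ∸ 1)) (trans (cong (q ^_) n≡pn′) (sym (^-*-assoc q n′ z))) ⟩
          ν z ((q ^ n′) ^ z ∸ 1)                 ≤⟨ lte-prime-≡ pz (q ^ n′) (2≤q^ q 2≤q n′ 1≤n′) z∣n′ (λ { refl → h4 refl z∣ }) ⟩
          ℓ n′ + 1                               ≤⟨ +-mono-≤ (≤-sum (∈-map⁺ ℓ n′∈)) (≤-reflexive (sym (ν-self pz))) ⟩
          sum (map ℓ (ods rs a)) + ν z z         ∎
          where
          open ≤-Reasoning
          1≤n′ : 1 ≤ n′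
          1≤n′ = 1≤*⇒1≤ˡ n′ p (subst (1 ≤_) n≡pn′ 1≤n)
          z∣n′ : z ∣ q ^ n′ ∸ 1
          z∣n′ = ∣-trans (proj₁ (proj₂ ord)) (q^∸1-mono-∣ q 2≤q
            (*-cancelˡ-∣ p {{prime⇒nonZero pp}} (subst (p * e ∣_) (trans n≡pn′ (*-comm n′ p)) ze∣n)))
          n′∈ : n′ ∈ ods rs a
          n′∈ with evs-top rest a
          ... | ds , eq , _ = ∈-++⁺ʳ (ods rest (p * a)) (subst (n′ ∈_) (sym eq) (here refl))
          -- If z divided q^d - 1, then e ∣ d and hence r e ∣ r d ∣ n for a prime r smaller than z,
          -- which `none` forbids.
          vanish : ∀ {m d} → m ∣ n → Deficient rest m d → ℓ d ≡ 0
          vanish {m} {d} m∣n (r , r∈ , h) = ℓ≡0 (positive (∣-trans (n∣m*n r) (∣-trans h m∣n)))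
            (λ z∣d → none′ (there r∈) r≢z (∣-trans (*-monoʳ-∣ r (order-∣ q 2≤q ord d z∣d)) (∣-trans h m∣n)))
            where
            r≢z : r ≢ z
            r≢z refl = <-irrefl refl (All.lookup (AllPairs.head sorted) r∈)
          evs-sum : sum (map ℓ (evs rs a)) ≡ ℓ n
          evs-sum with evs-top rest (p * a)
          ... | ds , eq , all = begin-equality
            sum (map ℓ (evs rest (p * a) ++ ods rest a))                 ≡⟨ cong (λ xs → sum (map ℓ (xs ++ ods rest a))) eq ⟩
            ℓ (product rest * (p * a)) + sum (map ℓ (ds ++ ods rest a))  ≡⟨ cong₂ _+_ (cong ℓ top≡) (sum-zeros ℓ (ds ++ ods rest a)
              (All.++⁺ (All.map (vanish (∣-reflexive top≡)) all) (All.map (vanish (divides p (trans n≡pn′ (*-comm n′ p)))) (ods-deficient rest a)))) ⟩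
            ℓ n + 0                                                      ≡⟨ +-identityʳ _ ⟩
            ℓ n                                                          ∎
            where
            top≡ : product rest * (p * a) ≡ n
            top≡ = trans (rearrange (product rest) p a) (sym n≡)
              where
              rearrange : ∀ P p a → P * (p * a) ≡ p * P * a
              rearrange = solve-∀

    private
      ods-∣ : All (_∣ n) (ods rs a)
      ods-∣ = All.map deficient-∣ (ods-deficient rs a)

      f : ℕ → ℕ
      f d = q ^ d ∸ 1

      f-pos : ∀ {ds} → All (_∣ n) ds → All (λ d → 1 ≤ f d) ds
      f-pos = All.map (λ d∣n → 1≤q^∸1 q 2≤q _ (positive d∣n))

    -- This says Φₙ(q) ≤ p, multiplied out so that no quotient has to be formed.
    cyclotomic-bound : product (map f (evs rs a)) ≤ p * product (map f (ods rs a))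
    cyclotomic-bound = ν-≤⇒≤ _ _ (proj₁ (ν-product pp f _ (f-pos evs-∣)))
      (*-mono-≤ (<⇒≤ (prime⇒2≤ pp)) (proj₁ (ν-product pp f _ (f-pos ods-∣)))) ν-compare
      where
      ν-compare : ∀ z → Prime z → ν z (product (map f (evs rs a))) ≤ ν z (p * product (map f (ods rs a)))
      ν-compare z pz = begin
        ν z (product (map f (evs rs a)))             ≡⟨ proj₂ (ν-product pz f _ (f-pos evs-∣)) ⟩
        sum (map (λ d → ν z (f d)) (evs rs a))       ≤⟨ local-bound pz ⟩
        sum (map (λ d → ν z (f d)) (ods rs a)) + ν z p ≡⟨ cong (_+ ν z p) (proj₂ (ν-product pz f _ (f-pos ods-∣))) ⟨
        ν z (product (map f (ods rs a))) + ν z p     ≡⟨ +-comm _ (ν z p) ⟩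
        ν z p + ν z (product (map f (ods rs a)))     ≡⟨ ν-* pz p _ (<⇒≤ (prime⇒2≤ pp)) (proj₁ (ν-product pz f _ (f-pos ods-∣))) ⟨
        ν z (p * product (map f (ods rs a)))         ∎
        where open ≤-Reasoning

    -- Each factor q^d - 1 lies between q^(d - 1) and q^d. The lower estimate loses one q for each
    -- of the `2 ^ length rest` even terms, and the remaining exponents combine to φ(n) by
    -- `sum-evs`.
    size-bound : q ^ (a * prodPred rs) ≤ p * q ^ (2 ^ length rest)
    size-bound = *-cancelʳ-≤ _ _ (q ^ sum (ods rs a)) {{>-nonZero (1≤q^ q 2≤q (sum (ods rs a)))}} (begin
      q ^ (a * prodPred rs) * q ^ sum (ods rs a)                 ≡⟨ trans (*-comm (q ^ (a * prodPred rs)) _) (sym (^-distribˡ-+-* q (sum (ods rs a)) _)) ⟩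
      q ^ (sum (ods rs a) + a * prodPred rs)                     ≡⟨ cong (q ^_) (sum-evs rs a (All.map (λ pr → <⇒≤ (prime⇒2≤ pr)) prs)) ⟨
      q ^ sum (evs rs a)                                         ≤⟨ lower (evs rs a) evs-∣ ⟩
      product (map f (evs rs a)) * q ^ length (evs rs a)         ≤⟨ *-monoˡ-≤ _ cyclotomic-bound ⟩
      p * product (map f (ods rs a)) * q ^ length (evs rs a)     ≤⟨ *-monoˡ-≤ _ (*-monoʳ-≤ p (upper (ods rs a))) ⟩
      p * q ^ sum (ods rs a) * q ^ length (evs rs a)             ≡⟨ cong (λ l → p * q ^ sum (ods rs a) * q ^ l) (length-evs-∷ p rest a) ⟩
      p * q ^ sum (ods rs a) * q ^ (2 ^ length rest)             ≡⟨ rearrange p (q ^ sum (ods rs a)) _ ⟩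
      p * q ^ (2 ^ length rest) * q ^ sum (ods rs a)             ∎)
      where
      open ≤-Reasoning
      rearrange : ∀ p x y → p * x * y ≡ p * y * x
      rearrange = solve-∀
      swap : ∀ a b c d → a * b * (c * d) ≡ a * c * (b * d)
      swap = solve-∀
      upper : ∀ ds → product (map f ds) ≤ q ^ sum ds
      upper [] = ≤-refl
      upper (d ∷ ds) = ≤-trans (*-mono-≤ (m∸n≤m (q ^ d) 1) (upper ds)) (≤-reflexive (sym (^-distribˡ-+-* q d (sum ds))))
      double : ∀ x → 1 ≤ x → suc x ≤ x * q
      double x 1≤x = ≤-trans (≤-trans (+-monoˡ-≤ x 1≤x) (≤-reflexive (cong (x +_) (sym (+-identityʳ x))))) (≤-trans (≤-reflexive (*-comm 2 x)) (*-monoʳ-≤ x 2≤q))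
      lower₁ : ∀ d → 1 ≤ d → q ^ d ≤ f d * q
      lower₁ d 1≤d = ≤-trans (≤-reflexive (trans (sym (m∸n+n≡m (1≤q^ q 2≤q d))) (+-comm (f d) 1)))
        (double (f d) (1≤q^∸1 q 2≤q d 1≤d))
      lower : ∀ ds → All (_∣ n) ds → q ^ sum ds ≤ product (map f ds) * q ^ length ds
      lower [] [] = ≤-refl
      lower (d ∷ ds) (h ∷ hs) = ≤-trans (≤-reflexive (^-distribˡ-+-* q d (sum ds)))
        (≤-trans (*-mono-≤ (lower₁ d (positive h)) (lower ds hs)) (≤-reflexive (swap (f d) q _ _)))

module _ (q : ℕ) (2≤q : 2 ≤ q) where

  primitive⊎nonPrimitive : ∀ n → 1 ≤ n → (∃ λ z → Prime z × IsOrder q 2≤q z n) ⊎ NonPrimitive q 2≤q n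
  primitive⊎nonPrimitive n 1≤n
    with factorise (q ^ n ∸ 1) {{>-nonZero (1≤q^∸1 q 2≤q n 1≤n)}}
  ... | record { factors = ps ; isFactorisation = eq ; factorsPrime = prs }
    with any? (λ z → ¬? (imprimitive? z)) ps
    where
    imprimitive? = λ z → anyUpTo? (λ b → (1 ≤? b) ×-dec (z ∣? q ^ b ∸ 1)) n
  ... | yes found with find found
  ...   | z , z∈ , none = inj₁ (z , All.lookup prs z∈ , 1≤n , subst (z ∣_) (sym eq) (∈⇒∣product z∈) ,
            λ m 1≤m h → ≮⇒≥ λ m<n → none (m , m<n , 1≤m , h))
  primitive⊎nonPrimitive n 1≤n
      | record { factors = ps ; isFactorisation = eq ; factorsPrime = prs } | no none = inj₂ nonPrim
    where
    nonPrim : NonPrimitive q 2≤q n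
    nonPrim z pz z∣ with anyUpTo? (λ b → (1 ≤? b) ×-dec (z ∣? q ^ b ∸ 1)) n
    ... | yes (b , b<n , 1≤b , h) = b , 1≤b , b<n , h
    ... | no ¬b = contradiction (lose (factorisationHasAllPrimeFactors pz (subst (z ∣_) eq z∣) prs) ¬b) none

-- The exponents to which the size estimate applies

1≤prodPred : ∀ {rs} → All Prime rs → 1 ≤ prodPred rs
1≤prodPred [] = ≤-refl
1≤prodPred (pr ∷ prs) = *-mono-≤ (∸-monoˡ-≤ 1 (prime⇒2≤ pr)) (1≤prodPred prs)

no-primes<2 : ∀ {rs} → All Prime rs → All (2 >_) rs → rs ≡ []
no-primes<2 [] [] = refl
no-primes<2 (pr ∷ _) (r<2 ∷ _) = contradiction (prime⇒2≤ pr) (<⇒≱ r<2)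

primes<3 : ∀ {rs} → All Prime rs → AllPairs _>_ rs → All (3 >_) rs → rs ≡ [] ⊎ rs ≡ 2 ∷ []
primes<3 [] [] [] = inj₁ refl
primes<3 {r ∷ _} (pr ∷ prs) (r> ∷ _) (r<3 ∷ _) with ≤-antisym (≤-pred r<3) (prime⇒2≤ pr)
... | refl = inj₂ (cong (2 ∷_) (no-primes<2 prs r>))

primes<5 : ∀ {rs} → All Prime rs → AllPairs _>_ rs → All (5 >_) rs →
           (rs ≡ [] ⊎ rs ≡ 2 ∷ []) ⊎ (rs ≡ 3 ∷ [] ⊎ rs ≡ 3 ∷ 2 ∷ [])
primes<5 [] [] [] = inj₁ (inj₁ refl)
primes<5 {0 ∷ _} (pr ∷ prs) _ _ = contradiction pr ¬prime[0]
primes<5 {1 ∷ _} (pr ∷ prs) _ _ = contradiction pr ¬prime[1]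
primes<5 {2 ∷ _} (pr ∷ prs) (r> ∷ _) _ = inj₁ (inj₂ (cong (2 ∷_) (no-primes<2 prs r>)))
primes<5 {3 ∷ _} (pr ∷ prs) (r> ∷ s) _ with primes<3 prs s r>
... | inj₁ refl = inj₂ (inj₁ refl)
... | inj₂ refl = inj₂ (inj₂ refl)
primes<5 {4 ∷ _} (pr ∷ prs) _ _ = contradiction pr (from-no (prime? 4))
primes<5 {suc (suc (suc (suc (suc _)))) ∷ _} (pr ∷ prs) _ (s≤s (s≤s (s≤s (s≤s (s≤s ())))) ∷ _)

-- Every r - 1 is at least 2 except at r = 2, which occurs at most once and is paid for by the
-- factor 2 on the right.
2^length≤ : ∀ {rs} → All Prime rs → AllPairs _>_ rs → 2 ^ length rs ≤ 2 * prodPred rs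
2^length≤ [] [] = s≤s z≤n
2^length≤ {r ∷ rs} (pr ∷ prs) (r> ∷ s) with r ≟ 2
... | yes refl with no-primes<2 prs r>
...   | refl = ≤-refl
2^length≤ {r ∷ rs} (pr ∷ prs) (r> ∷ s) | no r≢2 =
  *-monoʳ-≤ 2 (≤-trans (2^length≤ prs s) (*-monoˡ-≤ (prodPred rs) (∸-monoˡ-≤ 1 (≤∧≢⇒< (prime⇒2≤ pr) (λ eq → r≢2 (sym eq))))))

7+k<2^[4+k] : ∀ k → 7 + k < 2 ^ (4 + k)
7+k<2^[4+k] zero = from-yes (7 <? 16)
7+k<2^[4+k] (suc k) = ≤-trans (s≤s (subst (_≤ 2 ^ (4 + k)) (sym (+-suc 7 k)) (7+k<2^[4+k] k)))
  (≤-trans (+-monoˡ-≤ (2 ^ (4 + k)) (m^n>0 2 (4 + k))) (≤-reflexive (cong (2 ^ (4 + k) +_) (sym (+-identityʳ _)))))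

-- Contradicts size-bound.
record IsDominant (q p : ℕ) (rest : List ℕ) (a c : ℕ) : Set where
  constructor dominant
  field
    base-large     : p < q ^ c
    exponent-large : 2 ^ length rest + c ≤ a * prodPred (p ∷ rest)

-- With Y = `prodPred rest`, the estimate `2^length≤` uses up 2 Y of the available (p - 1) Y, which
-- leaves c = p - 3. The inequality p < 2^(p - 3) fails at p = 5, so the primes below 7 are treated
-- one by one.
large-dominant : ∀ q → 2 ≤ q → ∀ k rest a → 1 ≤ a → All Prime rest → AllPairs _>_ rest → IsDominant q (7 + k) rest a (4 + k)
large-dominant q 2≤q k rest a 1≤a prs sorted = dominant (<-≤-trans (7+k<2^[4+k] k) (^-monoˡ-≤ (4 + k) 2≤q)) (begin
  2 ^ length rest + (4 + k)         ≤⟨ +-mono-≤ (2^length≤ prs sorted) (≤-trans (≤-reflexive (sym (*-identityʳ (4 + k)))) (*-monoʳ-≤ (4 + k) (1≤prodPred prs))) ⟩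
  2 * Y + (4 + k) * Y               ≡⟨ rearrange k Y ⟩
  1 * ((6 + k) * Y)                 ≤⟨ *-monoˡ-≤ ((6 + k) * Y) 1≤a ⟩
  a * ((6 + k) * Y)                 ∎)
  where
  open ≤-Reasoning
  Y = prodPred rest
  rearrange : ∀ k Y → 2 * Y + (4 + k) * Y ≡ 1 * ((6 + k) * Y)
  rearrange = solve-∀

dominant-mono : ∀ {q p rest c} a b → b ≤ a → IsDominant q p rest b c → IsDominant q p rest a c
dominant-mono {p = p} {rest} a b b≤a (dominant h h′) = dominant h (≤-trans h′ (*-monoˡ-≤ (prodPred (p ∷ rest)) b≤a))

module _ (q : ℕ) (2≤q : 2 ≤ q) where

  dominant⇒primitive : ∀ {n p rest a c} → 1 ≤ n → All Prime (p ∷ rest) → AllPairs _>_ (p ∷ rest) →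
           (∀ {r} → Prime r → r ∣ n → r ∈ p ∷ rest) →
           n ≡ product (p ∷ rest) * a →
           (p ≡ 2 → 2 ∣ q ^ n ∸ 1 → 4 ∣ q ^ (product rest * a) ∸ 1) →
           IsDominant q p rest a c → ∃ λ z → Prime z × IsOrder q 2≤q z n
  dominant⇒primitive {n} {p} {rest} {a} {c} 1≤n prs sorted complete n≡ h4 (dominant p< c≤)
    with primitive⊎nonPrimitive q 2≤q n 1≤n
  ... | inj₁ z = z
  ... | inj₂ nonPrim = contradiction (size-bound q 2≤q 1≤n prs sorted complete n≡ h4 nonPrim) (<⇒≱ (begin-strict
    p * q ^ (2 ^ length rest)             <⟨ *-monoˡ-< (q ^ (2 ^ length rest)) {{>-nonZero (1≤q^ q 2≤q (2 ^ length rest))}} p< ⟩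
    q ^ c * q ^ (2 ^ length rest)         ≡⟨ trans (*-comm (q ^ c) _) (sym (^-distribˡ-+-* q (2 ^ length rest) c)) ⟩
    q ^ (2 ^ length rest + c)             ≤⟨ ^-monoʳ-≤ q {{>-nonZero (<⇒≤ 2≤q)}} c≤ ⟩
    q ^ (a * prodPred (p ∷ rest))         ∎))
    where open ≤-Reasoning

2≤card : ∀ Q → 2 ≤ card Q
2≤card q2 = s≤s (s≤s z≤n)
2≤card q3 = s≤s (s≤s z≤n)

5<card^3 : ∀ Q → 5 < card Q ^ 3
5<card^3 q2 = from-yes (5 <? 8)
5<card^3 q3 = from-yes (5 <? 27)

-- The four exponents in the conclusion do have primitive primes, but φ(n) is too small there for
-- the crude estimate.
dominance : ∀ Q {n p rest a} → 1 ≤ a → ¬ n ∣ dq Q → All Prime (p ∷ rest) → AllPairs _>_ (p ∷ rest) →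
            n ≡ product (p ∷ rest) * a →
            (∃ λ c → IsDominant (card Q) p rest a c) ⊎ (Q ≡ q2 × (n ≡ 4 ⊎ n ≡ 10)) ⊎ (Q ≡ q3 × (n ≡ 3 ⊎ n ≡ 6))
dominance Q {p = 0} 1≤a n∤d (pp ∷ prs) sorted n≡ = contradiction pp ¬prime[0]
dominance Q {p = 1} 1≤a n∤d (pp ∷ prs) sorted n≡ = contradiction pp ¬prime[1]
dominance Q {p = 2} 1≤a n∤d (pp ∷ prs) (p> ∷ _) n≡ with no-primes<2 prs p>
dominance q2 {p = 2} {a = 1} 1≤a n∤d _ _ refl | refl = contradiction (from-yes (2 ∣? 6)) n∤d
dominance q2 {p = 2} {a = 2} 1≤a n∤d _ _ refl | refl = inj₂ (inj₁ (refl , inj₁ refl))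
dominance q2 {p = 2} {a = a@(suc (suc (suc _)))} 1≤a n∤d _ _ n≡ | refl =
  inj₁ (2 , dominant-mono a 3 (s≤s (s≤s (s≤s z≤n))) (dominant (from-yes (2 <? 4)) (from-yes (3 ≤? 3))))
dominance q3 {p = 2} {a = 1} 1≤a n∤d _ _ refl | refl = contradiction (from-yes (2 ∣? 2)) n∤d
dominance q3 {p = 2} {a = a@(suc (suc _))} 1≤a n∤d _ _ n≡ | refl =
  inj₁ (1 , dominant-mono a 2 (s≤s (s≤s z≤n)) (dominant (from-yes (2 <? 3)) (from-yes (2 ≤? 2))))
dominance Q {p = 3} 1≤a n∤d (pp ∷ prs) (p> ∷ s) n≡ with primes<3 prs s p>
dominance q2 {p = 3} {a = 1} 1≤a n∤d _ _ refl | inj₁ refl = contradiction (from-yes (3 ∣? 6)) n∤d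
dominance q2 {p = 3} {a = 1} 1≤a n∤d _ _ refl | inj₂ refl = contradiction (from-yes (6 ∣? 6)) n∤d
dominance q3 {p = 3} {a = 1} 1≤a n∤d _ _ refl | inj₁ refl = inj₂ (inj₂ (refl , inj₁ refl))
dominance q3 {p = 3} {a = 1} 1≤a n∤d _ _ refl | inj₂ refl = inj₂ (inj₂ (refl , inj₂ refl))
dominance Q {p = 3} {a = a@(suc (suc _))} 1≤a n∤d _ _ n≡ | h =
  inj₁ (2 , dominant-mono a 2 (s≤s (s≤s z≤n)) (dominant (3<q^2 Q) (two h)))
  where
  3<q^2 : ∀ Q → 3 < card Q ^ 2
  3<q^2 q2 = from-yes (3 <? 4)
  3<q^2 q3 = from-yes (3 <? 9)
  two : ∀ {rest} → rest ≡ [] ⊎ rest ≡ 2 ∷ [] → 2 ^ length rest + 2 ≤ 2 * prodPred (3 ∷ rest)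
  two (inj₁ refl) = from-yes (3 ≤? 4)
  two (inj₂ refl) = from-yes (4 ≤? 4)
dominance Q {p = 4} 1≤a n∤d (pp ∷ prs) sorted n≡ = contradiction pp (from-no (prime? 4))
dominance Q {p = 5} 1≤a n∤d (pp ∷ prs) (p> ∷ s) n≡ with primes<5 prs s p>
dominance q2 {p = 5} {a = 1} 1≤a n∤d _ _ refl | inj₁ (inj₂ refl) = inj₂ (inj₁ (refl , inj₂ refl))
dominance q3 {p = 5} {a = 1} 1≤a n∤d _ _ refl | inj₁ (inj₂ refl) = inj₁ (2 , dominant (from-yes (5 <? 9)) (from-yes (4 ≤? 4)))
dominance Q {p = 5} {a = a@(suc (suc _))} 1≤a n∤d _ _ n≡ | inj₁ (inj₂ refl) =
  inj₁ (3 , dominant-mono a 2 (s≤s (s≤s z≤n)) (dominant (5<card^3 Q) (from-yes (5 ≤? 8))))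
dominance Q {p = 5} {a = a} 1≤a n∤d _ _ n≡ | inj₁ (inj₁ refl) =
  inj₁ (3 , dominant-mono a 1 1≤a (dominant (5<card^3 Q) (from-yes (4 ≤? 4))))
dominance Q {p = 5} {a = a} 1≤a n∤d _ _ n≡ | inj₂ h =
  inj₁ (3 , dominant-mono a 1 1≤a (dominant (5<card^3 Q) (three h)))
  where
  three : ∀ {rest} → rest ≡ 3 ∷ [] ⊎ rest ≡ 3 ∷ 2 ∷ [] → 2 ^ length rest + 3 ≤ 1 * prodPred (5 ∷ rest)
  three (inj₁ refl) = from-yes (5 ≤? 8)
  three (inj₂ refl) = from-yes (7 ≤? 8)
dominance Q {p = 6} 1≤a n∤d (pp ∷ prs) sorted n≡ = contradiction pp (from-no (prime? 6))
dominance Q {p = suc (suc (suc (suc (suc (suc (suc k))))))} {rest} {a} 1≤a n∤d (pp ∷ prs) (_ ∷ s) n≡ =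
  inj₁ (4 + k , large-dominant (card Q) (2≤card Q) k rest a 1≤a prs s)

-- For q = 2 the number q^n - 1 is odd. For q = 3, if 2 is the only prime of n and n does not divide
-- 2, then a = n / 2 is even and 3^2 - 1 = 8 divides 3^a - 1. At n = 2 the conclusion would fail.
lifting-at-2 : ∀ Q {n p rest a} → 1 ≤ n → ¬ n ∣ dq Q → All Prime (p ∷ rest) → AllPairs _>_ (p ∷ rest) →
               (∀ {r} → Prime r → r ∣ n → r ∈ p ∷ rest) → n ≡ product (p ∷ rest) * a →
               p ≡ 2 → 2 ∣ card Q ^ n ∸ 1 → 4 ∣ card Q ^ (product rest * a) ∸ 1
lifting-at-2 q2 {n} 1≤n n∤d prs sorted complete n≡ refl 2∣ =
  contradiction ∣-refl (prime∣q^∸1⇒∤q 2 (s≤s (s≤s z≤n)) prime[2] n 1≤n 2∣)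
lifting-at-2 q3 {n} {rest = rest} {a} 1≤n n∤d (_ ∷ prs) (p> ∷ _) complete n≡ refl 2∣ with no-primes<2 prs p>
... | refl = ∣-trans (divides 2 refl) (q^∸1-mono-∣ 3 (s≤s (s≤s z≤n)) {2} (subst (2 ∣_) (sym (+-identityʳ a)) 2∣a))
  where
  2≤a : ∀ a → n ≡ 2 * a → 2 ≤ a
  2≤a zero refl = contradiction 1≤n λ ()
  2≤a (suc zero) refl = contradiction ∣-refl n∤d
  2≤a (suc (suc a)) eq = s≤s (s≤s z≤n)
  2∣a : 2 ∣ a
  2∣a with primeDivisor a (2≤a a n≡)
  ... | r , pr , r∣a with complete pr (∣-trans r∣a (subst (a ∣_) (sym n≡) (n∣m*n 2)))
  ... | here refl = r∣a

order-check : ∀ q 2≤q z e → (∀ {m} → m < e → 1 ≤ m → ¬ z ∣ q ^ m ∸ 1) → 1 ≤ e → z ∣ q ^ e ∸ 1 → IsOrder q 2≤q z e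
order-check q 2≤q z e none 1≤e z∣ = 1≤e , z∣ , λ m 1≤m h → ≮⇒≥ λ m<e → none m<e 1≤m h

zsigmondy : ∀ Q n → 1 ≤ n → ¬ n ∣ dq Q → ∃ λ z → Prime z × IsOrder (card Q) (2≤card Q) z n
zsigmondy Q n 1≤n n∤d with radical n 1≤n
... | record { primes = [] ; complete = complete } =
        contradiction (complete (proj₁ (proj₂ pd)) (proj₂ (proj₂ pd))) λ ()
  where
  pd = primeDivisor n (≤∧≢⇒< 1≤n λ { refl → n∤d (1∣ _) })
... | record { primes = p ∷ rest ; cofactor = a ; isPrime = prs ; sorted = sorted ; complete = complete ; eq = n≡ }
  with dominance Q (1≤*⇒1≤ʳ (product (p ∷ rest)) a (subst (1 ≤_) n≡ 1≤n)) n∤d prs sorted n≡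
... | inj₁ (c , dom) = dominant⇒primitive (card Q) (2≤card Q) 1≤n prs sorted complete n≡
        (lifting-at-2 Q 1≤n n∤d prs sorted complete n≡) dom
-- The exponents that escape the estimate get explicit primes: 5 and 11 for 2^4 - 1 and 2^10 - 1,
-- then 13 and 7 for 3^3 - 1 and 3^6 - 1.
... | inj₂ (inj₁ (refl , inj₁ refl)) = 5 , from-yes (prime? 5) ,
        order-check 2 (2≤card q2) 5 4 (from-yes (allUpTo? (λ m → (1 ≤? m) →-dec ¬? (5 ∣? 2 ^ m ∸ 1)) 4)) 1≤n (from-yes (5 ∣? 15))
... | inj₂ (inj₁ (refl , inj₂ refl)) = 11 , from-yes (prime? 11) ,
        order-check 2 (2≤card q2) 11 10 (from-yes (allUpTo? (λ m → (1 ≤? m) →-dec ¬? (11 ∣? 2 ^ m ∸ 1)) 10)) 1≤n (from-yes (11 ∣? 1023))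
... | inj₂ (inj₂ (refl , inj₁ refl)) = 13 , from-yes (prime? 13) ,
        order-check 3 (2≤card q3) 13 3 (from-yes (allUpTo? (λ m → (1 ≤? m) →-dec ¬? (13 ∣? 3 ^ m ∸ 1)) 3)) 1≤n (from-yes (13 ∣? 26))
... | inj₂ (inj₂ (refl , inj₂ refl)) = 7 , from-yes (prime? 7) ,
        order-check 3 (2≤card q3) 7 6 (from-yes (allUpTo? (λ m → (1 ≤? m) →-dec ¬? (7 ∣? 3 ^ m ∸ 1)) 6)) 1≤n (from-yes (7 ∣? 728))

-- The ring 𝔽_q[T]

module _ where
  open Poly

  +F-comm : ∀ Q a b → _+F_ Q a b ≡ _+F_ Q b a
  +F-comm q2 = from-yes (all? λ a → all? λ b → _+F_ q2 a b ≟F _+F_ q2 b a)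
  +F-comm q3 = from-yes (all? λ a → all? λ b → _+F_ q3 a b ≟F _+F_ q3 b a)

  +F-assoc : ∀ Q a b c → _+F_ Q (_+F_ Q a b) c ≡ _+F_ Q a (_+F_ Q b c)
  +F-assoc q2 = from-yes (all? λ a → all? λ b → all? λ c → _+F_ q2 (_+F_ q2 a b) c ≟F _+F_ q2 a (_+F_ q2 b c))
  +F-assoc q3 = from-yes (all? λ a → all? λ b → all? λ c → _+F_ q3 (_+F_ q3 a b) c ≟F _+F_ q3 a (_+F_ q3 b c))

  +F-identityˡ : ∀ Q a → _+F_ Q (0F Q) a ≡ a
  +F-identityˡ q2 = from-yes (all? λ a → _+F_ q2 (0F q2) a ≟F a)
  +F-identityˡ q3 = from-yes (all? λ a → _+F_ q3 (0F q3) a ≟F a)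

  *F-comm : ∀ Q a b → _*F_ Q a b ≡ _*F_ Q b a
  *F-comm q2 = from-yes (all? λ a → all? λ b → _*F_ q2 a b ≟F _*F_ q2 b a)
  *F-comm q3 = from-yes (all? λ a → all? λ b → _*F_ q3 a b ≟F _*F_ q3 b a)

  *F-assoc : ∀ Q a b c → _*F_ Q (_*F_ Q a b) c ≡ _*F_ Q a (_*F_ Q b c)
  *F-assoc q2 = from-yes (all? λ a → all? λ b → all? λ c → _*F_ q2 (_*F_ q2 a b) c ≟F _*F_ q2 a (_*F_ q2 b c))
  *F-assoc q3 = from-yes (all? λ a → all? λ b → all? λ c → _*F_ q3 (_*F_ q3 a b) c ≟F _*F_ q3 a (_*F_ q3 b c))

  *F-identityˡ : ∀ Q a → _*F_ Q (1F Q) a ≡ a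
  *F-identityˡ q2 = from-yes (all? λ a → _*F_ q2 (1F q2) a ≟F a)
  *F-identityˡ q3 = from-yes (all? λ a → _*F_ q3 (1F q3) a ≟F a)

  *F-zeroˡ : ∀ Q a → _*F_ Q (0F Q) a ≡ 0F Q
  *F-zeroˡ q2 = from-yes (all? λ a → _*F_ q2 (0F q2) a ≟F 0F q2)
  *F-zeroˡ q3 = from-yes (all? λ a → _*F_ q3 (0F q3) a ≟F 0F q3)

  *F-distribˡ : ∀ Q a b c → _*F_ Q a (_+F_ Q b c) ≡ _+F_ Q (_*F_ Q a b) (_*F_ Q a c)
  *F-distribˡ q2 = from-yes (all? λ a → all? λ b → all? λ c → _*F_ q2 a (_+F_ q2 b c) ≟F _+F_ q2 (_*F_ q2 a b) (_*F_ q2 a c))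
  *F-distribˡ q3 = from-yes (all? λ a → all? λ b → all? λ c → _*F_ q3 a (_+F_ q3 b c) ≟F _+F_ q3 (_*F_ q3 a b) (_*F_ q3 a c))

  -- The residue q - 1; negation of polynomials thereby becomes a case of `scale`.
  -1F : ∀ Q → F Q
  -1F Q = cardP Q mod q Q

  -F-inverseʳ : ∀ Q a → _+F_ Q a (_*F_ Q (-1F Q) a) ≡ 0F Q
  -F-inverseʳ q2 = from-yes (all? λ a → _+F_ q2 a (_*F_ q2 (-1F q2) a) ≟F 0F q2)
  -F-inverseʳ q3 = from-yes (all? λ a → _+F_ q3 a (_*F_ q3 (-1F q3) a) ≟F 0F q3)

  -- In 𝔽₂ and 𝔽₃ every unit is its own inverse.
  unit-square : ∀ Q a → ¬ a ≡ 0F Q → _*F_ Q a a ≡ 1F Q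
  unit-square q2 = from-yes (all? λ a → ¬? (a ≟F 0F q2) →-dec (_*F_ q2 a a ≟F 1F q2))
  unit-square q3 = from-yes (all? λ a → ¬? (a ≟F 0F q3) →-dec (_*F_ q3 a a ≟F 1F q3))

  1F≢0F : ∀ Q → ¬ 1F Q ≡ 0F Q
  1F≢0F q2 ()
  1F≢0F q3 ()

module PolyRing (Q : Qs) where
  open Poly Q

  *F-zeroʳ : ∀ a → a *F 0F ≡ 0F
  *F-zeroʳ a = trans (*F-comm Q a 0F) (*F-zeroˡ Q a)

  +F-identityʳ : ∀ a → a +F 0F ≡ a
  +F-identityʳ a = trans (+F-comm Q a 0F) (+F-identityˡ Q a)

  coef : List F → ℕ → F
  coef []       _       = 0F
  coef (x ∷ xs) zero    = x
  coef (x ∷ xs) (suc n) = coef xs n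

  infix 4 _≈_
  -- Equality up to trailing zeros. As a record, unlike a bare family of equations, it lets both
  -- lists be inferred from a proof.
  record _≈_ (xs ys : List F) : Set where
    constructor ⟪_⟫
    field at : ∀ n → coef xs n ≡ coef ys n
  open _≈_ public

  scale : F → List F → List F
  scale c = map (c *F_)

  ≈-refl : ∀ {xs} → xs ≈ xs
  ≈-refl = ⟪ (λ n → refl) ⟫

  ≈-sym : ∀ {xs ys} → xs ≈ ys → ys ≈ xs
  ≈-sym ⟪ h ⟫ = ⟪ (λ n → sym (h n)) ⟫

  ≈-trans : ∀ {xs ys zs} → xs ≈ ys → ys ≈ zs → xs ≈ zs
  ≈-trans ⟪ h ⟫ ⟪ g ⟫ = ⟪ (λ n → trans (h n) (g n)) ⟫

  ≈-isEquivalence : IsEquivalence _≈_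
  ≈-isEquivalence = record { refl = ≈-refl ; sym = ≈-sym ; trans = ≈-trans }

  ≈-setoid : Setoid 0ℓ 0ℓ
  ≈-setoid = record { isEquivalence = ≈-isEquivalence }

  open import Relation.Binary.Reasoning.Setoid ≈-setoid

  coef-addL : ∀ xs ys n → coef (addL xs ys) n ≡ coef xs n +F coef ys n
  coef-addL []       ys       n       = sym (+F-identityˡ Q _)
  coef-addL (x ∷ xs) []       n       = sym (+F-identityʳ _)
  coef-addL (x ∷ xs) (y ∷ ys) zero    = refl
  coef-addL (x ∷ xs) (y ∷ ys) (suc n) = coef-addL xs ys n

  coef-scale : ∀ c xs n → coef (scale c xs) n ≡ c *F coef xs n
  coef-scale c []       n       = sym (*F-zeroʳ c)
  coef-scale c (x ∷ xs) zero    = refl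
  coef-scale c (x ∷ xs) (suc n) = coef-scale c xs n

  ∷-cong : ∀ {x y xs ys} → x ≡ y → xs ≈ ys → x ∷ xs ≈ y ∷ ys
  ∷-cong x≡y ⟪ h ⟫ = ⟪ (λ { zero → x≡y ; (suc n) → h n }) ⟫

  0∷[]≈[] : 0F ∷ [] ≈ []
  0∷[]≈[] = ⟪ (λ { zero → refl ; (suc n) → refl }) ⟫

  addL-cong : ∀ {xs xs′ ys ys′} → xs ≈ xs′ → ys ≈ ys′ → addL xs ys ≈ addL xs′ ys′
  addL-cong {xs} {xs′} {ys} {ys′} ⟪ h ⟫ ⟪ g ⟫ =
    ⟪ (λ n → trans (coef-addL xs ys n) (trans (cong₂ _+F_ (h n) (g n)) (sym (coef-addL xs′ ys′ n)))) ⟫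

  addL-comm : ∀ xs ys → addL xs ys ≈ addL ys xs
  addL-comm xs ys = ⟪ (λ n → trans (coef-addL xs ys n) (trans (+F-comm Q (coef xs n) (coef ys n)) (sym (coef-addL ys xs n)))) ⟫

  addL-assoc : ∀ xs ys zs → addL (addL xs ys) zs ≈ addL xs (addL ys zs)
  addL-assoc xs ys zs = ⟪ (λ n → trans (coef-addL (addL xs ys) zs n) (trans (cong (_+F coef zs n) (coef-addL xs ys n))
    (trans (+F-assoc Q (coef xs n) (coef ys n) (coef zs n)) (sym (trans (coef-addL xs (addL ys zs) n) (cong (coef xs n +F_) (coef-addL ys zs n))))))) ⟫

  addL-identityʳ : ∀ xs → addL xs [] ≈ xs
  addL-identityʳ []      = ≈-refl
  addL-identityʳ (_ ∷ _) = ≈-refl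

  addL-interchange : ∀ ws xs ys zs → addL (addL ws xs) (addL ys zs) ≈ addL (addL ws ys) (addL xs zs)
  addL-interchange ws xs ys zs = begin
    addL (addL ws xs) (addL ys zs) ≈⟨ addL-assoc ws xs _ ⟩
    addL ws (addL xs (addL ys zs)) ≈⟨ addL-cong (≈-refl {ws}) (≈-sym (addL-assoc xs ys zs)) ⟩
    addL ws (addL (addL xs ys) zs) ≈⟨ addL-cong (≈-refl {ws}) (addL-cong (addL-comm xs ys) (≈-refl {zs})) ⟩
    addL ws (addL (addL ys xs) zs) ≈⟨ addL-cong (≈-refl {ws}) (addL-assoc ys xs zs) ⟩
    addL ws (addL ys (addL xs zs)) ≈⟨ addL-assoc ws ys _ ⟨
    addL (addL ws ys) (addL xs zs) ∎

  scale-cong : ∀ c {xs ys} → xs ≈ ys → scale c xs ≈ scale c ys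
  scale-cong c {xs} {ys} ⟪ h ⟫ = ⟪ (λ n → trans (coef-scale c xs n) (trans (cong (c *F_) (h n)) (sym (coef-scale c ys n)))) ⟫

  scale-addL : ∀ c xs ys → scale c (addL xs ys) ≈ addL (scale c xs) (scale c ys)
  scale-addL c xs ys = ⟪ (λ n → trans (coef-scale c (addL xs ys) n) (trans (cong (c *F_) (coef-addL xs ys n))
    (trans (*F-distribˡ Q c (coef xs n) (coef ys n)) (sym (trans (coef-addL (scale c xs) (scale c ys) n) (cong₂ _+F_ (coef-scale c xs n) (coef-scale c ys n))))))) ⟫

  scale-scale : ∀ c d xs → scale c (scale d xs) ≈ scale (c *F d) xs
  scale-scale c d xs = ⟪ (λ n → trans (coef-scale c (scale d xs) n) (trans (cong (c *F_) (coef-scale d xs n))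
    (trans (sym (*F-assoc Q c d (coef xs n))) (sym (coef-scale (c *F d) xs n))))) ⟫

  scale-0 : ∀ xs → scale 0F xs ≈ []
  scale-0 xs = ⟪ (λ n → trans (coef-scale 0F xs n) (*F-zeroˡ Q (coef xs n))) ⟫

  scale-1 : ∀ xs → scale 1F xs ≈ xs
  scale-1 xs = ⟪ (λ n → trans (coef-scale 1F xs n) (*F-identityˡ Q _)) ⟫

  shift-addL : ∀ xs ys → 0F ∷ addL xs ys ≈ addL (0F ∷ xs) (0F ∷ ys)
  shift-addL xs ys = ∷-cong (sym (+F-identityˡ Q 0F)) ≈-refl

  shift-scale : ∀ c xs → 0F ∷ scale c xs ≈ scale c (0F ∷ xs)
  shift-scale c xs = ∷-cong (sym (*F-zeroʳ c)) ≈-refl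

  mulL-congʳ : ∀ xs {ys zs} → ys ≈ zs → mulL xs ys ≈ mulL xs zs
  mulL-congʳ []       h = ≈-refl
  mulL-congʳ (x ∷ xs) h = addL-cong (scale-cong x h) (∷-cong refl (mulL-congʳ xs h))

  mulL-zeroʳ : ∀ xs → mulL xs [] ≈ []
  mulL-zeroʳ []       = ≈-refl
  mulL-zeroʳ (x ∷ xs) = ≈-trans (∷-cong refl (mulL-zeroʳ xs)) 0∷[]≈[]

  mulL-∷ʳ : ∀ xs y ys → mulL xs (y ∷ ys) ≈ addL (scale y xs) (0F ∷ mulL xs ys)
  mulL-∷ʳ []       y ys = ≈-sym 0∷[]≈[]
  mulL-∷ʳ (x ∷ xs) y ys = ∷-cong (cong (_+F 0F) (*F-comm Q x y)) (begin
    addL (scale x ys) (mulL xs (y ∷ ys))                       ≈⟨ addL-cong ≈-refl (mulL-∷ʳ xs y ys) ⟩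
    addL (scale x ys) (addL (scale y xs) (0F ∷ mulL xs ys))    ≈⟨ addL-assoc (scale x ys) (scale y xs) _ ⟨
    addL (addL (scale x ys) (scale y xs)) (0F ∷ mulL xs ys)    ≈⟨ addL-cong (addL-comm (scale x ys) (scale y xs)) ≈-refl ⟩
    addL (addL (scale y xs) (scale x ys)) (0F ∷ mulL xs ys)    ≈⟨ addL-assoc (scale y xs) (scale x ys) _ ⟩
    addL (scale y xs) (addL (scale x ys) (0F ∷ mulL xs ys))    ∎)

  mulL-comm : ∀ xs ys → mulL xs ys ≈ mulL ys xs
  mulL-comm []       ys = ≈-sym (mulL-zeroʳ ys)
  mulL-comm (x ∷ xs) ys = ≈-trans (addL-cong ≈-refl (∷-cong refl (mulL-comm xs ys))) (≈-sym (mulL-∷ʳ ys x xs))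

  mulL-congˡ : ∀ {xs ys} zs → xs ≈ ys → mulL xs zs ≈ mulL ys zs
  mulL-congˡ {xs} {ys} zs h = ≈-trans (mulL-comm xs zs) (≈-trans (mulL-congʳ zs h) (mulL-comm zs ys))

  mulL-distribˡ : ∀ xs ys zs → mulL xs (addL ys zs) ≈ addL (mulL xs ys) (mulL xs zs)
  mulL-distribˡ []       ys zs = ≈-refl
  mulL-distribˡ (x ∷ xs) ys zs = begin
    addL (scale x (addL ys zs)) (0F ∷ mulL xs (addL ys zs))
      ≈⟨ addL-cong (scale-addL x ys zs) (≈-trans (∷-cong refl (mulL-distribˡ xs ys zs)) (shift-addL (mulL xs ys) (mulL xs zs))) ⟩
    addL (addL (scale x ys) (scale x zs)) (addL (0F ∷ mulL xs ys) (0F ∷ mulL xs zs))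
      ≈⟨ addL-interchange (scale x ys) (scale x zs) _ _ ⟩
    addL (mulL (x ∷ xs) ys) (mulL (x ∷ xs) zs) ∎

  mulL-distribʳ : ∀ zs xs ys → mulL (addL xs ys) zs ≈ addL (mulL xs zs) (mulL ys zs)
  mulL-distribʳ zs xs ys = ≈-trans (mulL-comm (addL xs ys) zs) (≈-trans (mulL-distribˡ zs xs ys)
    (addL-cong (mulL-comm zs xs) (mulL-comm zs ys)))

  mulL-scaleˡ : ∀ c xs ys → mulL (scale c xs) ys ≈ scale c (mulL xs ys)
  mulL-scaleˡ c []       ys = ≈-refl
  mulL-scaleˡ c (x ∷ xs) ys = begin
    addL (scale (c *F x) ys) (0F ∷ mulL (scale c xs) ys)
      ≈⟨ addL-cong (≈-sym (scale-scale c x ys)) (≈-trans (∷-cong refl (mulL-scaleˡ c xs ys)) (shift-scale c (mulL xs ys))) ⟩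
    addL (scale c (scale x ys)) (scale c (0F ∷ mulL xs ys))
      ≈⟨ scale-addL c (scale x ys) _ ⟨
    scale c (mulL (x ∷ xs) ys) ∎

  mulL-shiftˡ : ∀ xs ys → mulL (0F ∷ xs) ys ≈ 0F ∷ mulL xs ys
  mulL-shiftˡ xs ys = addL-cong (scale-0 ys) ≈-refl

  mulL-assoc : ∀ xs ys zs → mulL (mulL xs ys) zs ≈ mulL xs (mulL ys zs)
  mulL-assoc []       ys zs = ≈-refl
  mulL-assoc (x ∷ xs) ys zs = begin
    mulL (addL (scale x ys) (0F ∷ mulL xs ys)) zs
      ≈⟨ mulL-distribʳ zs (scale x ys) _ ⟩
    addL (mulL (scale x ys) zs) (mulL (0F ∷ mulL xs ys) zs)
      ≈⟨ addL-cong (mulL-scaleˡ x ys zs) (≈-trans (mulL-shiftˡ (mulL xs ys) zs) (∷-cong refl (mulL-assoc xs ys zs))) ⟩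
    addL (scale x (mulL ys zs)) (0F ∷ mulL xs (mulL ys zs)) ∎

  mulL-identityˡ : ∀ xs → mulL [ 1F ] xs ≈ xs
  mulL-identityˡ xs = ≈-trans (addL-cong (scale-1 xs) 0∷[]≈[]) (addL-identityʳ xs)

  negL : List F → List F
  negL = scale (-1F Q)

  addL-inverseʳ : ∀ xs → addL xs (negL xs) ≈ []
  addL-inverseʳ xs = ⟪ (λ n → trans (coef-addL xs (negL xs) n)
    (trans (cong (coef xs n +F_) (coef-scale (-1F Q) xs n)) (-F-inverseʳ Q (coef xs n)))) ⟫

  polyRing : CommutativeRing 0ℓ 0ℓ
  polyRing = record
    { Carrier = List F ; _≈_ = _≈_ ; _+_ = addL ; _*_ = mulL ; -_ = negL ; 0# = [] ; 1# = [ 1F ]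
    ; isCommutativeRing = record
      { isRing = record
        { +-isAbelianGroup = record
          { isGroup = record
            { isMonoid = record
              { isSemigroup = record
                { isMagma = record { isEquivalence = ≈-isEquivalence ; ∙-cong = addL-cong }
                ; assoc = addL-assoc }
              ; identity = (λ xs → ≈-refl) , addL-identityʳ }
            ; inverse = (λ xs → ≈-trans (addL-comm (negL xs) xs) (addL-inverseʳ xs)) , addL-inverseʳ
            ; ⁻¹-cong = scale-cong (-1F Q) }
          ; comm = addL-comm }
        ; *-cong = λ {xs} {ys} {us} {vs} h g → ≈-trans (mulL-congˡ us h) (mulL-congʳ ys g)
        ; *-assoc = mulL-assoc
        ; *-identity = mulL-identityˡ , λ xs → ≈-trans (mulL-comm xs [ 1F ]) (mulL-identityˡ xs)
        ; distrib = mulL-distribˡ , mulL-distribʳ }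
      ; *-comm = mulL-comm } }

  -- The coefficient c may be `0F`, so this bounds the degree and names one coefficient. Where the
  -- exact degree matters, c ≢ 0 is asked for separately.
  Lead : ℕ → F → List F → Set
  Lead n c xs = coef xs n ≡ c × (∀ m → n < m → coef xs m ≡ 0F)

  lead-resp : ∀ {n c xs ys} → xs ≈ ys → Lead n c xs → Lead n c ys
  lead-resp ⟪ h ⟫ (eq , z) = trans (sym (h _)) eq , λ m n<m → trans (sym (h m)) (z m n<m)

  lead-unique : ∀ {n m c d xs} → ¬ c ≡ 0F → ¬ d ≡ 0F → Lead n c xs → Lead m d xs → n ≡ m × c ≡ d
  lead-unique {n} {m} c≢0 d≢0 (eq , z) (eq′ , z′) with <-cmp n m
  ... | tri< n<m _ _ = contradiction (trans (sym eq′) (z m n<m)) d≢0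
  ... | tri≈ _ refl _ = refl , trans (sym eq) eq′
  ... | tri> _ _ m<n = contradiction (trans (sym eq) (z′ n m<n)) c≢0

  zero⊎lead : ∀ xs → xs ≈ [] ⊎ (∃₂ λ n c → ¬ c ≡ 0F × Lead n c xs)
  zero⊎lead [] = inj₁ ≈-refl
  zero⊎lead (x ∷ xs) with zero⊎lead xs
  ... | inj₂ (n , c , c≢0 , eq , z) = inj₂ (suc n , c , c≢0 , eq , λ { (suc m) (s≤s n<m) → z m n<m })
  ... | inj₁ h with x ≟F 0F
  ...   | yes x≡0 = inj₁ (≈-trans (∷-cong x≡0 h) 0∷[]≈[])
  ...   | no x≢0 = inj₂ (0 , x , x≢0 , refl , λ { (suc m) _ → at h m })

  private
    coef-mulL-∷ : ∀ x xs ys k → coef (mulL (x ∷ xs) ys) (suc k) ≡ (x *F coef ys (suc k)) +F coef (mulL xs ys) k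
    coef-mulL-∷ x xs ys k = trans (coef-addL (scale x ys) _ (suc k)) (cong (_+F coef (mulL xs ys) k) (coef-scale x ys (suc k)))

  lead-mulL : ∀ n {m c d} xs {ys} → Lead n c xs → Lead m d ys → Lead (n + m) (c *F d) (mulL xs ys)
  lead-mulL n {m} {c} {d} [] (refl , z) _ = sym (*F-zeroˡ Q d) , λ _ _ → refl
  lead-mulL zero {m} {c} {d} (x ∷ xs) {ys} (refl , z) (eq , z′) =
    trans (scaled m) (cong (x *F_) eq) , λ k m<k → trans (scaled k) (trans (cong (x *F_) (z′ k m<k)) (*F-zeroʳ x))
    where
    xs≈[] : xs ≈ []
    xs≈[] = ⟪ (λ n → z (suc n) (s≤s z≤n)) ⟫
    scaled : ∀ k → coef (mulL (x ∷ xs) ys) k ≡ x *F coef ys k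
    scaled k = trans (at (≈-trans (addL-cong (≈-refl {scale x ys}) (≈-trans (∷-cong refl (mulL-congˡ ys xs≈[])) 0∷[]≈[])) (addL-identityʳ (scale x ys))) k)
      (coef-scale x ys k)
  lead-mulL (suc n) {m} {c} {d} (x ∷ xs) {ys} (eq , z) lead-ys@(eq′ , z′)
    with lead-mulL n xs {ys} (eq , λ k n<k → z (suc k) (s≤s n<k)) lead-ys
  ... | e , zz = trans (drop (n + m) (s≤s (m≤n+m m n))) e ,
    λ { (suc k) (s≤s h) → trans (drop k (s≤s (≤-trans (m≤n+m m n) (<⇒≤ h)))) (zz k h) }
    where
    drop : ∀ k → m < suc k → coef (mulL (x ∷ xs) ys) (suc k) ≡ coef (mulL xs ys) k
    drop k m<k = trans (coef-mulL-∷ x xs ys k) (trans (cong (_+F _) (trans (cong (x *F_) (z′ (suc k) m<k)) (*F-zeroʳ x))) (+F-identityˡ Q _))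

  lead-full : ∀ A → Lead (deg A) 1F (full A)
  lead-full (zero , []) = refl , λ { (suc m) _ → refl }
  lead-full (suc n , x ∷ v) with lead-full (n , v)
  ... | eq , z = eq , λ { (suc m) (s≤s h) → z m h }

  full-injective : ∀ {A B} → full A ≈ full B → A ≡ B
  full-injective {A} {B} h with lead-unique {xs = full B} (1F≢0F Q) (1F≢0F Q) (lead-resp h (lead-full A)) (lead-full B)
  full-injective {n , u} {n , v} h | refl , _ = cong (n ,_) (vec-injective u v h)
    where
    vec-injective : ∀ {n} (u v : Vec F n) → toList u ++ [ 1F ] ≈ toList v ++ [ 1F ] → u ≡ v
    vec-injective [] [] h = refl
    vec-injective (x ∷ u) (y ∷ v) ⟪ h ⟫ = cong₂ _∷_ (h 0) (vec-injective u v ⟪ (λ n → h (suc n)) ⟫)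

  -- The coefficients from position n on are cut off and a leading 1 is implied, so the polynomial
  -- is recovered only under `Lead n 1F xs`.
  monic : ℕ → List F → Monic
  monic n xs = n , takeV n xs

  full-monic : ∀ n xs → Lead n 1F xs → full (monic n xs) ≈ xs
  full-monic n xs lead = ⟪ go n xs lead ⟫
    where
    go : ∀ n xs → Lead n 1F xs → ∀ k → coef (full (monic n xs)) k ≡ coef xs k
    go zero xs (eq , z) zero = sym eq
    go zero xs (eq , z) (suc k) = sym (z (suc k) (s≤s z≤n))
    go (suc n) [] (eq , z) zero = refl
    go (suc n) [] (eq , z) (suc k) = go n [] (eq , λ _ _ → refl) k
    go (suc n) (x ∷ xs) (eq , z) zero = refl
    go (suc n) (x ∷ xs) (eq , z) (suc k) = go n xs (eq , λ m h → z (suc m) (s≤s h)) k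

  full-*M : ∀ A B → full (A *M B) ≈ mulL (full A) (full B)
  full-*M A B = full-monic (deg A + deg B) _
    (subst (λ c → Lead (deg A + deg B) c (mulL (full A) (full B))) (*F-identityˡ Q 1F)
      (lead-mulL (deg A) (full A) (lead-full A) (lead-full B)))

  *M-comm : ∀ A B → A *M B ≡ B *M A
  *M-comm A B = full-injective (≈-trans (full-*M A B) (≈-trans (mulL-comm (full A) (full B)) (≈-sym (full-*M B A))))

  *M-assoc : ∀ A B C → (A *M B) *M C ≡ A *M (B *M C)
  *M-assoc A B C = full-injective (begin
    full ((A *M B) *M C)                   ≈⟨ full-*M (A *M B) C ⟩
    mulL (full (A *M B)) (full C)          ≈⟨ mulL-congˡ (full C) (full-*M A B) ⟩
    mulL (mulL (full A) (full B)) (full C) ≈⟨ mulL-assoc (full A) (full B) (full C) ⟩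
    mulL (full A) (mulL (full B) (full C)) ≈⟨ mulL-congʳ (full A) (full-*M B C) ⟨
    mulL (full A) (full (B *M C))          ≈⟨ full-*M A (B *M C) ⟨
    full (A *M (B *M C))                   ∎)

  *M-identityˡ : ∀ A → oneM *M A ≡ A
  *M-identityˡ A = full-injective (≈-trans (full-*M oneM A) (mulL-identityˡ (full A)))

  *M-identityʳ : ∀ A → A *M oneM ≡ A
  *M-identityʳ A = trans (*M-comm A oneM) (*M-identityˡ A)

  mulL-full-zero : ∀ A xs → mulL (full A) xs ≈ [] → xs ≈ []
  mulL-full-zero A xs h with zero⊎lead xs
  ... | inj₁ xs≈[] = xs≈[]
  ... | inj₂ (m , c , c≢0 , lead) = contradiction
    (trans (sym (*F-identityˡ Q c)) (trans (sym (proj₁ (lead-mulL (deg A) (full A) (lead-full A) lead))) (at h _))) c≢0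

  *M-cancelˡ : ∀ A {B C} → A *M B ≡ A *M C → B ≡ C
  *M-cancelˡ A {B} {C} eq = full-injective (x∙y⁻¹≈ε⇒x≈y (full B) (full C) (mulL-full-zero A _ (begin
    mulL (full A) (addL (full B) (negL (full C)))                  ≈⟨ mulL-distribˡ (full A) (full B) _ ⟩
    addL (mulL (full A) (full B)) (mulL (full A) (negL (full C)))  ≈⟨ addL-cong (≈-sym (full-*M A B)) (≈-sym (-‿distribʳ-* (full A) (full C))) ⟩
    addL (full (A *M B)) (negL (mulL (full A) (full C)))           ≈⟨ addL-cong (≈-refl {full (A *M B)}) (scale-cong (-1F Q) (≈-trans (≈-sym (full-*M A C)) (subst (λ X → full (A *M C) ≈ full X) (sym eq) ≈-refl))) ⟩
    addL (full (A *M B)) (negL (full (A *M B)))                    ≈⟨ addL-inverseʳ (full (A *M B)) ⟩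
    []                                                             ∎)))
    where
    open import Algebra.Properties.Ring (CommutativeRing.ring polyRing) using (-‿distribʳ-*; x∙y⁻¹≈ε⇒x≈y)

  -- Divisibility and division with remainder

  infix 4 _∣L_
  -- Divisibility in the whole ring: remainders and differences may vanish or fail to be monic,
  -- which puts them outside the scope of `_∣M_`.
  record _∣L_ (xs ys : List F) : Set where
    constructor divL
    field
      quotientL : List F
      equalityL : mulL xs quotientL ≈ ys

  ∣L-mulˡ : ∀ {xs ys} zs → xs ∣L ys → xs ∣L mulL ys zs
  ∣L-mulˡ {xs} zs (divL hs h) = divL (mulL hs zs) (≈-trans (≈-sym (mulL-assoc xs hs zs)) (mulL-congˡ zs h))

  ∣L-add : ∀ {xs ys zs} → xs ∣L ys → xs ∣L zs → xs ∣L addL ys zs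
  ∣L-add {xs} (divL hs h) (divL gs g) = divL (addL hs gs) (≈-trans (mulL-distribˡ xs hs gs) (addL-cong h g))

  ∣L-scale : ∀ {xs ys} c → xs ∣L ys → xs ∣L scale c ys
  ∣L-scale {xs} {ys} c (divL hs h) = divL (scale c hs) (≈-trans (mulL-comm xs (scale c hs)) (≈-trans (mulL-scaleˡ c hs xs)
    (scale-cong c (≈-trans (mulL-comm hs xs) h))))

  ∣L-resp : ∀ {xs ys zs} → ys ≈ zs → xs ∣L ys → xs ∣L zs
  ∣L-resp ys≈zs (divL hs h) = divL hs (≈-trans h ys≈zs)

  ∣L-cancel : ∀ {xs ys zs} → xs ∣L addL ys zs → xs ∣L ys → xs ∣L zs
  ∣L-cancel {xs} {ys} {zs} d e = ∣L-resp (begin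
    addL (negL ys) (addL ys zs)  ≈⟨ addL-assoc (negL ys) ys zs ⟨
    addL (addL (negL ys) ys) zs  ≈⟨ addL-cong (≈-trans (addL-comm (negL ys) ys) (addL-inverseʳ ys)) (≈-refl {zs}) ⟩
    zs                           ∎) (∣L-add (∣L-scale (-1F Q) e) d)

  ∣M⇒∣L : ∀ A B → A ∣M B → full A ∣L full B
  ∣M⇒∣L A _ (H , refl) = divL (full H) (≈-sym (full-*M A H))

  -- A cofactor of monic polynomials is itself monic, as comparing leading coefficients gives 1 · c
  -- = 1.
  ∣L⇒∣M : ∀ A B → full A ∣L full B → A ∣M B
  ∣L⇒∣M A B (divL hs h) with zero⊎lead hs
  ... | inj₁ hs≈[] = contradiction (trans (sym (proj₁ (lead-full B)))
          (at (≈-trans (≈-sym h) (≈-trans (mulL-congʳ (full A) hs≈[]) (mulL-zeroʳ (full A)))) (deg B))) (1F≢0F Q)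
  ... | inj₂ (m , c , c≢0 , lead) = monic m hs , full-injective
      (≈-trans (full-*M A (monic m hs)) (≈-trans (mulL-congʳ (full A) (full-monic m hs lead₁)) h))
    where
    lead-B : Lead (deg A + m) c (full B)
    lead-B = lead-resp h (subst (λ c → Lead (deg A + m) c (mulL (full A) hs)) (*F-identityˡ Q c) (lead-mulL (deg A) (full A) (lead-full A) lead))
    lead₁ : Lead m 1F hs
    lead₁ = subst (λ c → Lead m c hs) (proj₂ (lead-unique {xs = full B} c≢0 (1F≢0F Q) lead-B (lead-full B))) lead

  -- Horner-style division: dividing T·X + x reduces to dividing X.
  divide : ∀ P xs → ∃₂ λ qs rs → xs ≈ addL (mulL (full P) qs) rs × (∀ m → deg P ≤ m → coef rs m ≡ 0F)
  divide P [] = [] , [] , ≈-sym (≈-trans (addL-identityʳ (mulL (full P) [])) (mulL-zeroʳ (full P))) , λ _ _ → refl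
  divide P (x ∷ xs) with divide P xs
  ... | qs , rs , eq , small = c ∷ qs , rs′ , eq′ , small′
    where
    p = full P
    c = coef (x ∷ rs) (deg P)
    rs′ = addL (x ∷ rs) (negL (scale c p))
    eq′ : x ∷ xs ≈ addL (mulL p (c ∷ qs)) rs′
    eq′ = ≈-sym (begin
      addL (mulL p (c ∷ qs)) rs′
        ≈⟨ addL-cong (≈-trans (mulL-∷ʳ p c qs) (addL-comm (scale c p) _)) (addL-comm (x ∷ rs) _) ⟩
      addL (addL (0F ∷ mulL p qs) (scale c p)) (addL (negL (scale c p)) (x ∷ rs))
        ≈⟨ addL-assoc (0F ∷ mulL p qs) (scale c p) _ ⟩
      addL (0F ∷ mulL p qs) (addL (scale c p) (addL (negL (scale c p)) (x ∷ rs)))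
        ≈⟨ addL-cong (≈-refl {0F ∷ mulL p qs}) (≈-trans (≈-sym (addL-assoc (scale c p) _ (x ∷ rs))) (addL-cong (addL-inverseʳ (scale c p)) (≈-refl {x ∷ rs}))) ⟩
      addL (0F ∷ mulL p qs) (x ∷ rs)
        ≈⟨ ∷-cong (+F-identityˡ Q x) (≈-sym eq) ⟩
      x ∷ xs ∎)
    coef-rs′ : ∀ m → coef rs′ m ≡ coef (x ∷ rs) m +F ((-1F Q) *F (c *F coef p m))
    coef-rs′ m = trans (coef-addL (x ∷ rs) (negL (scale c p)) m) (cong (coef (x ∷ rs) m +F_) (trans (coef-scale (-1F Q) (scale c p) m) (cong ((-1F Q) *F_) (coef-scale c p m))))
    small′ : ∀ m → deg P ≤ m → coef rs′ m ≡ 0F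
    small′ m h with <-cmp (deg P) m
    ... | tri> _ _ m<P = contradiction (≤-trans m<P h) (<-irrefl refl)
    ... | tri≈ _ refl _ = trans (coef-rs′ m) (trans (cong (λ y → c +F ((-1F Q) *F y))
            (trans (cong (c *F_) (proj₁ (lead-full P))) (trans (*F-comm Q c 1F) (*F-identityˡ Q c)))) (-F-inverseʳ Q c))
    small′ (suc m) h | tri< (s≤s P≤m) _ _ = trans (coef-rs′ (suc m)) (trans (cong₂ _+F_ (small m P≤m)
            (trans (cong ((-1F Q) *F_) (trans (cong (c *F_) (proj₂ (lead-full P) (suc m) (s≤s P≤m))) (*F-zeroʳ c))) (*F-zeroʳ (-1F Q)))) (+F-identityˡ Q 0F))

  deg0⇒one : ∀ A → deg A ≡ 0 → A ≡ oneM
  deg0⇒one (zero , []) refl = refl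

  ∣M⇒deg≤ : ∀ A B → A ∣M B → deg A ≤ deg B
  ∣M⇒deg≤ A _ (H , refl) = m≤m+n (deg A) (deg H)

  -- A nonzero remainder becomes monic on scaling by its own leading coefficient c. Since c² = 1,
  -- the same c undoes the scaling.
  normalise : ∀ {k rs} → (∀ m → k ≤ m → coef rs m ≡ 0F) →
              rs ≈ [] ⊎ (∃₂ λ c R → deg R < k × full R ≈ scale c rs × rs ≈ scale c (full R))
  normalise {k} {rs} small with zero⊎lead rs
  ... | inj₁ h = inj₁ h
  ... | inj₂ (m , c , c≢0 , eq , z) = inj₂ (c , monic m (scale c rs) , m<k , full≈ , rs≈)
    where
    m<k : m < k
    m<k with k ≤? m
    ... | yes k≤m = contradiction (trans (sym eq) (small m k≤m)) c≢0
    ... | no k≰m = ≰⇒> k≰m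
    lead₁ : Lead m 1F (scale c rs)
    lead₁ = trans (coef-scale c rs m) (trans (cong (c *F_) eq) (unit-square Q c c≢0)) ,
            λ j m<j → trans (coef-scale c rs j) (trans (cong (c *F_) (z j m<j)) (*F-zeroʳ c))
    full≈ = full-monic m (scale c rs) lead₁
    rs≈ : rs ≈ scale c (full (monic m (scale c rs)))
    rs≈ = ≈-sym (begin
      scale c (full (monic m (scale c rs))) ≈⟨ scale-cong c full≈ ⟩
      scale c (scale c rs)                  ≈⟨ scale-scale c c rs ⟩
      scale (c *F c) rs                     ≡⟨ cong (λ u → scale u rs) (unit-square Q c c≢0) ⟩
      scale 1F rs                           ≈⟨ scale-1 rs ⟩
      rs                                    ∎)

  -- Gauss's descent: A is replaced by A mod P, or by P mod A once deg A < deg P.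
  euclidL : ∀ {P} → IsPrime P → ∀ A bs → Acc _<_ (deg A) → ¬ P ∣M A → full P ∣L mulL (full A) bs → full P ∣L bs
  euclidL {P} (1≤P , irr) A bs (acc rec) P∤A d with deg P ≤? deg A
  ... | yes P≤A with divide P (full A)
  ...   | qs , rs , eq , small with normalise {deg P} {rs} small
  ...     | inj₁ rs≈[] = contradiction (∣L⇒∣M P A (divL qs (≈-sym (≈-trans eq (≈-trans (addL-cong (≈-refl {mulL (full P) qs}) rs≈[]) (addL-identityʳ _)))))) P∤A
  ...     | inj₂ (c , R , R<P , R≈ , rs≈) =
    euclidL (1≤P , irr) R bs (rec (<-≤-trans R<P P≤A)) P∤R
      (∣L-resp (≈-trans (≈-sym (mulL-scaleˡ c rs bs)) (mulL-congˡ bs (≈-sym R≈))) (∣L-scale c P∣rs*bs))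
    where
    P∣rs*bs : full P ∣L mulL rs bs
    P∣rs*bs = ∣L-cancel (∣L-resp (≈-trans (mulL-congˡ bs eq) (mulL-distribʳ bs (mulL (full P) qs) rs)) d)
                (∣L-mulˡ bs (divL qs ≈-refl))
    P∤R : ¬ P ∣M R
    P∤R P∣R = P∤A (∣L⇒∣M P A (∣L-resp (≈-sym eq) (∣L-add (divL qs ≈-refl) (∣L-resp (≈-sym rs≈) (∣L-scale c (∣M⇒∣L P R P∣R))))))
  euclidL {P} (1≤P , irr) A bs (acc rec) P∤A d | no P≰A with divide A (full P)
  ... | qs , rs , eq , small with normalise {deg A} {rs} small
  ...   | inj₂ (c , R , R<A , R≈ , rs≈) =
    euclidL (1≤P , irr) R bs (rec R<A) P∤R
      (∣L-resp (≈-trans (≈-sym (mulL-scaleˡ c rs bs)) (mulL-congˡ bs (≈-sym R≈))) (∣L-scale c P∣rs*bs))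
    where
    P∣rs*bs : full P ∣L mulL rs bs
    P∣rs*bs = ∣L-cancel (∣L-resp (≈-trans (mulL-congˡ bs eq) (mulL-distribʳ bs (mulL (full A) qs) rs)) (divL bs ≈-refl))
      (∣L-resp (begin
        mulL (mulL (full A) bs) qs ≈⟨ mulL-assoc (full A) bs qs ⟩
        mulL (full A) (mulL bs qs) ≈⟨ mulL-congʳ (full A) (mulL-comm bs qs) ⟩
        mulL (full A) (mulL qs bs) ≈⟨ mulL-assoc (full A) qs bs ⟨
        mulL (mulL (full A) qs) bs ∎) (∣L-mulˡ qs d))
    P∤R : ¬ P ∣M R
    P∤R P∣R = <-irrefl refl (≤-trans (≤-<-trans (∣M⇒deg≤ P R P∣R) R<A) (<⇒≤ (≰⇒> P≰A)))
  -- Now A divides P: either A = 1 and the claim is the hypothesis `d`, or A = P, which has the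
  -- wrong degree.
  ...   | inj₁ rs≈[] with irr A (∣L⇒∣M A P (divL qs (≈-sym (≈-trans eq (≈-trans (addL-cong (≈-refl {mulL (full A) qs}) rs≈[]) (addL-identityʳ _))))))
  ...     | inj₁ refl = ∣L-resp (mulL-identityˡ bs) d
  ...     | inj₂ refl = contradiction ≤-refl P≰A

-- Unique factorisation and the divisor sum

module _ {A : Set} where

  ∈⇒↭∷ : ∀ {x : A} {ys} → x ∈ ys → ∃ λ zs → ys ↭ x ∷ zs
  ∈⇒↭∷ {x} x∈ with ∈-∃++ x∈
  ... | as , bs , refl = as ++ bs , shift x as bs

  unique-resp-↭ : ∀ {xs ys : List A} → xs ↭ ys → Unique xs → Unique ys
  unique-resp-↭ p = Unique-resp-↭ (↭⇒↭ₛ p)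
    where open import Data.List.Relation.Binary.Permutation.Setoid.Properties (setoid A) using (Unique-resp-↭)

  unique-⊆⇒↭ : ∀ {xs ys : List A} → Unique xs → Unique ys →
               (∀ {x} → x ∈ xs → x ∈ ys) → (∀ {x} → x ∈ ys → x ∈ xs) → xs ↭ ys
  unique-⊆⇒↭ u u′ ⊆ ⊇ = ∼bag⇒↭ (unique∧set⇒bag u u′ (mk⇔ ⊆ ⊇))

  unique-⊆⇒length≤ : ∀ {xs ys : List A} → Unique xs → (∀ {x} → x ∈ xs → x ∈ ys) → length xs ≤ length ys
  unique-⊆⇒length≤ {[]} _ _ = z≤n
  unique-⊆⇒length≤ {x ∷ xs} (x∉ ∷ u) ⊆ with ∈⇒↭∷ (⊆ (here refl))
  ... | zs , p = subst (suc (length xs) ≤_) (sym (↭-length p)) (s≤s (unique-⊆⇒length≤ u ⊆′))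
    where
    ⊆′ : ∀ {w} → w ∈ xs → w ∈ zs
    ⊆′ w∈ with ∈-resp-↭ p (⊆ (there w∈))
    ... | here refl = contradiction refl (All.lookup x∉ w∈)
    ... | there h = h

module Factorisation (Q : Qs) where
  open Poly Q
  open PolyRing Q

  eqL⇒≡ : ∀ xs ys → T (eqL xs ys) → xs ≡ ys
  eqL⇒≡ []       []       _ = refl
  eqL⇒≡ (x ∷ xs) (y ∷ ys) h with Equivalence.to (T-∧ {⌊ x ≟F y ⌋}) h
  ... | a , b = cong₂ _∷_ (toWitness a) (eqL⇒≡ xs ys b)

  eqL-refl : ∀ xs → T (eqL xs xs)
  eqL-refl []       = _
  eqL-refl (x ∷ xs) = Equivalence.from (T-∧ {⌊ x ≟F x ⌋}) (fromWitness refl , eqL-refl xs)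

  eqM⇒≡ : ∀ A B → T (eqM A B) → A ≡ B
  eqM⇒≡ A B h = full-injective (subst (full A ≈_) (eqL⇒≡ (full A) (full B) h) ≈-refl)

  vecsOf-complete : ∀ {k} (v : Vec F k) → v ∈ vecsOf k
  vecsOf-complete []      = here refl
  vecsOf-complete (x ∷ v) = ∈-concatMap⁺ (λ a → map (a ∷_) (vecsOf _)) (lose (∈-allFin x) (∈-map⁺ (x ∷_) (vecsOf-complete v)))

  vecsOf-unique : ∀ k → Unique (vecsOf k)
  vecsOf-unique zero    = [] ∷ []
  vecsOf-unique (suc k) = Unique.concat⁺
    (All.map⁺ (All.universal (λ a → Unique.map⁺ (λ { refl → refl }) (vecsOf-unique k)) (allFin q)))
    (AllPairs.map⁺ (AllPairs.map disjoint (Unique.allFin⁺ q)))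
    where
    disjoint : ∀ {a b} → a ≢ b → ∀ {v} → ¬ (v ∈ map (a ∷_) (vecsOf k) × v ∈ map (b ∷_) (vecsOf k))
    disjoint a≢b (p , r) with ∈-map⁻ _ p | ∈-map⁻ _ r
    ... | _ , _ , refl | _ , _ , refl = a≢b refl

  monicsOfDeg-complete : ∀ A → A ∈ monicsOfDeg (deg A)
  monicsOfDeg-complete (k , v) = ∈-map⁺ (k ,_) (vecsOf-complete v)

  monicsUpTo-complete : ∀ {A n} → deg A ≤ n → A ∈ monicsUpTo n
  monicsUpTo-complete {A} h = ∈-concatMap⁺ monicsOfDeg (lose (∈-upTo⁺ (s≤s h)) (monicsOfDeg-complete A))

  monicsUpTo-unique : ∀ n → Unique (monicsUpTo n)
  monicsUpTo-unique n = Unique.concat⁺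
    (All.map⁺ (All.universal (λ k → Unique.map⁺ (λ { refl → refl }) (vecsOf-unique k)) (upTo (suc n))))
    (AllPairs.map⁺ (AllPairs.map disjoint (Unique.upTo⁺ (suc n))))
    where
    disjoint : ∀ {a b} → a ≢ b → ∀ {A} → ¬ (A ∈ monicsOfDeg a × A ∈ monicsOfDeg b)
    disjoint a≢b (p , r) with ∈-map⁻ _ p | ∈-map⁻ _ r
    ... | _ , _ , refl | _ , _ , refl = a≢b refl

  one⊎pos : ∀ A → A ≡ oneM ⊎ 1 ≤ deg A
  one⊎pos (zero , [])  = inj₁ refl
  one⊎pos (suc k , _) = inj₂ (s≤s z≤n)

  divB⇒∣ : ∀ D G → T (divB D G) → D ∣M G
  divB⇒∣ D G h with find (any⁻ (λ H → eqM (D *M H) G) (monicsOfDeg (deg G ∸ deg D)) (proj₂ (Equivalence.to (T-∧ {deg D ≤ᵇ deg G}) h)))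
  ... | H , _ , eq = H , eqM⇒≡ (D *M H) G eq

  ∣⇒divB : ∀ D G → D ∣M G → T (divB D G)
  ∣⇒divB D G (H , refl) = Equivalence.from (T-∧ {deg D ≤ᵇ deg G}) (≤⇒≤ᵇ (m≤m+n (deg D) (deg H)) ,
    any⁺ (λ H → eqM (D *M H) G) (lose (subst (λ k → H ∈ monicsOfDeg k) (sym (m+n∸m≡n (deg D) (deg H))) (monicsOfDeg-complete H)) (eqL-refl (full G))))

  _∣M?_ : ∀ D G → Dec (D ∣M G)
  D ∣M? G = map′ (divB⇒∣ D G) (∣⇒divB D G) (T? (divB D G))

  euclid : ∀ {P} → IsPrime P → ∀ A B → P ∣M (A *M B) → P ∣M A ⊎ P ∣M B
  euclid {P} pP A B d with P ∣M? A
  ... | yes h = inj₁ h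
  ... | no P∤A = inj₂ (∣L⇒∣M P B (euclidL pP A (full B) (<-wellFounded (deg A)) P∤A
          (∣L-resp (full-*M A B) (∣M⇒∣L P (A *M B) d))))

  ∣M-refl : ∀ A → A ∣M A
  ∣M-refl A = oneM , *M-identityʳ A

  ∣M-trans : ∀ A B C → A ∣M B → B ∣M C → A ∣M C
  ∣M-trans A B C (H , refl) (K , refl) = H *M K , sym (*M-assoc A H K)

  ∣M-*ˡ : ∀ A B C → A ∣M B → A ∣M (C *M B)
  ∣M-*ˡ A B C (H , refl) = H *M C , trans (sym (*M-assoc A H C)) (*M-comm (A *M H) C)

  ∣M-one : ∀ A → A ∣M oneM → A ≡ oneM
  ∣M-one A (H , eq) = deg0⇒one A (m+n≡0⇒m≡0 (deg A) (cong deg eq))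

  prime≢one : ∀ {P} → IsPrime P → ¬ P ≡ oneM
  prime≢one (1≤P , _) refl = contradiction 1≤P λ ()

  prime∤one : ∀ {P} → IsPrime P → ¬ P ∣M oneM
  prime∤one {P} pP d = prime≢one pP (∣M-one P d)

  prime-∣-primeM : ∀ {P R} → IsPrime P → IsPrime R → P ∣M R → P ≡ R
  prime-∣-primeM {P} pP (_ , irr) d with irr P d
  ... | inj₁ P≡1 = contradiction P≡1 (prime≢one pP)
  ... | inj₂ eq = eq

  prime-∣-powM : ∀ {P R} → IsPrime P → IsPrime R → ∀ k → P ∣M powM R k → P ≡ R
  prime-∣-powM pP pR zero d = contradiction d (prime∤one pP)
  prime-∣-powM {P} {R} pP pR (suc k) d with euclid pP R (powM R k) d
  ... | inj₁ h = prime-∣-primeM pP pR h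
  ... | inj₂ h = prime-∣-powM pP pR k h

  prime-∣-prodM : ∀ {P} → IsPrime P → ∀ As → P ∣M prodM As → Any (P ∣M_) As
  prime-∣-prodM pP [] d = contradiction d (prime∤one pP)
  prime-∣-prodM pP (A ∷ As) d with euclid pP A (prodM As) d
  ... | inj₁ h = here h
  ... | inj₂ h = there (prime-∣-prodM pP As h)

  private
    properDivisor : Monic → Monic → Bool
    properDivisor P D = (1 ≤ᵇ deg D) ∧ ((deg D <ᵇ deg P) ∧ divB D P)

  -- The search inside `primeB` is analysed only here; both implications between `primeB` and
  -- `IsPrime`, and the existence of prime divisors, follow from this alternative.
  primeB⊎divisor : ∀ P → 1 ≤ deg P → (T (primeB P) × IsPrime P) ⊎ (∃ λ D → 1 ≤ deg D × deg D < deg P × D ∣M P)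
  primeB⊎divisor P 1≤P with any (properDivisor P) (monicsUpTo (deg P)) in eq
  ... | true with find (any⁻ (properDivisor P) (monicsUpTo (deg P)) (Equivalence.from T-≡ eq))
  ...   | D , _ , h with Equivalence.to (T-∧ {1 ≤ᵇ deg D}) h
  ...     | a , b with Equivalence.to (T-∧ {deg D <ᵇ deg P}) b
  ...       | b₁ , b₂ = inj₂ (D , ≤ᵇ⇒≤ 1 (deg D) a , <ᵇ⇒< (deg D) (deg P) b₁ , divB⇒∣ D P b₂)
  primeB⊎divisor P 1≤P | false = inj₁ (Equivalence.from (T-∧ {1 ≤ᵇ deg P}) (≤⇒≤ᵇ 1≤P , _) , 1≤P , irr)
    where
    irr : ∀ D → D ∣M P → D ≡ oneM ⊎ D ≡ P
    irr D (H , DH≡P) with one⊎pos D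
    ... | inj₁ D≡1 = inj₁ D≡1
    ... | inj₂ 1≤D with <-cmp (deg D) (deg P)
    ...   | tri≈ _ D≡P _ = inj₂ (trans (sym (*M-identityʳ D)) (trans (cong (D *M_) (sym H≡1)) DH≡P))
      where
      H≡1 : H ≡ oneM
      H≡1 = deg0⇒one H (+-cancelˡ-≡ (deg D) (deg H) 0 (trans (cong deg DH≡P) (trans (sym D≡P) (sym (+-identityʳ (deg D))))))
    ...   | tri> _ _ P<D = contradiction (∣M⇒deg≤ D P (H , DH≡P)) (<⇒≱ P<D)
    ...   | tri< D<P _ _ = ⊥-elim (subst T eq (any⁺ (properDivisor P) (lose (monicsUpTo-complete {D} (<⇒≤ D<P))
              (Equivalence.from (T-∧ {1 ≤ᵇ deg D}) (≤⇒≤ᵇ 1≤D ,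
               Equivalence.from (T-∧ {deg D <ᵇ deg P}) (<⇒<ᵇ D<P , ∣⇒divB D P (H , DH≡P)))))))

  primeB⇒prime : ∀ P → T (primeB P) → IsPrime P
  primeB⇒prime P h with Equivalence.to (T-∧ {1 ≤ᵇ deg P}) h
  ... | 1≤P , h′ with primeB⊎divisor P (≤ᵇ⇒≤ 1 (deg P) 1≤P)
  ...   | inj₁ (_ , pP) = pP
  ...   | inj₂ (D , 1≤D , D<P , D∣P) = ⊥-elim (T-not (any⁺ (properDivisor P) (lose (monicsUpTo-complete {D} (<⇒≤ D<P))
              (Equivalence.from (T-∧ {1 ≤ᵇ deg D}) (≤⇒≤ᵇ 1≤D ,
               Equivalence.from (T-∧ {deg D <ᵇ deg P}) (<⇒<ᵇ D<P , ∣⇒divB D P D∣P))))) h′)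
    where
    T-not : ∀ {b} → T b → T (not b) → ⊥
    T-not {true} _ ()

  prime⇒primeB : ∀ P → IsPrime P → T (primeB P)
  prime⇒primeB P (1≤P , irr) with primeB⊎divisor P 1≤P
  ... | inj₁ (h , _) = h
  ... | inj₂ (D , 1≤D , D<P , D∣P) with irr D D∣P
  ...   | inj₁ refl = contradiction 1≤D λ ()
  ...   | inj₂ refl = contradiction D<P (<-irrefl refl)

  primeDivisorM : ∀ G → 1 ≤ deg G → Acc _<_ (deg G) → ∃ λ P → IsPrime P × P ∣M G
  primeDivisorM G 1≤G (acc rec) with primeB⊎divisor G 1≤G
  ... | inj₁ (_ , pG) = G , pG , ∣M-refl G
  ... | inj₂ (D , 1≤D , D<G , D∣G) with primeDivisorM D 1≤D (rec D<G)
  ...   | P , pP , P∣D = P , pP , ∣M-trans P D G P∣D D∣G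

  coprime-by-primes : ∀ A B → (∀ P → IsPrime P → P ∣M A → ¬ P ∣M B) → Coprime A B
  coprime-by-primes A B h D D∣A D∣B with one⊎pos D
  ... | inj₁ D≡1 = D≡1
  ... | inj₂ 1≤D with primeDivisorM D 1≤D (<-wellFounded (deg D))
  ...   | P , pP , P∣D = ⊥-elim (h P pP (∣M-trans P D A P∣D D∣A) (∣M-trans P D B P∣D D∣B))

  pullOut : ∀ P → IsPrime P → ∀ G → Acc _<_ (deg G) → ∃₂ λ v H → G ≡ powM P v *M H × ¬ P ∣M H
  pullOut P pP G (acc rec) with P ∣M? G
  ... | no P∤G = 0 , G , sym (*M-identityˡ G) , P∤G
  ... | yes (K , refl) with pullOut P pP K (rec (m<n+m (deg K) (proj₁ pP)))
  ...   | v , H , refl , P∤H = suc v , H , sym (*M-assoc P (powM P v) H) , P∤H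

  powersOf : Monic × ℕ → Monic
  powersOf (P , v) = powM P v

  record PrimePowers (G : Monic) : Set where
    field
      factors : List (Monic × ℕ)
      primes  : All (λ f → IsPrime (proj₁ f) × 1 ≤ proj₂ f) factors
      unique  : Unique (map proj₁ factors)
      eq      : G ≡ prodM (map powersOf factors)

  prime∣product⇒∈ : ∀ {P} → IsPrime P → ∀ fs → All (λ f → IsPrime (proj₁ f) × 1 ≤ proj₂ f) fs →
                    P ∣M prodM (map powersOf fs) → P ∈ map proj₁ fs
  prime∣product⇒∈ pP [] [] d = contradiction d (prime∤one pP)
  prime∣product⇒∈ {P} pP ((R , v) ∷ fs) ((pR , _) ∷ all) d with euclid pP (powM R v) _ d
  ... | inj₁ h = here (prime-∣-powM pP pR v h)
  ... | inj₂ h = there (prime∣product⇒∈ pP fs all h)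

  factor∣product : ∀ {A} As → A ∈ As → A ∣M prodM As
  factor∣product {A} (A ∷ As) (here refl) = prodM As , refl
  factor∣product {A} (B ∷ As) (there A∈) = ∣M-*ˡ A (prodM As) B (factor∣product As A∈)

  prime∣powM : ∀ P v → 1 ≤ v → P ∣M powM P v
  prime∣powM P (suc v) _ = powM P v , refl

  ∈⇒prime∣product : ∀ {P} fs → All (λ f → IsPrime (proj₁ f) × 1 ≤ proj₂ f) fs → P ∈ map proj₁ fs →
                    P ∣M prodM (map powersOf fs)
  ∈⇒prime∣product fs all P∈ with ∈-map⁻ proj₁ P∈
  ... | (P , v) , f∈ , refl = ∣M-trans P (powM P v) _ (prime∣powM P v (proj₂ (All.lookup all f∈)))
          (factor∣product (map powersOf fs) (∈-map⁺ powersOf f∈))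

  factoriseM : ∀ G → Acc _<_ (deg G) → PrimePowers G
  factoriseM G (acc rec) with one⊎pos G
  ... | inj₁ G≡1 = record { factors = [] ; primes = [] ; unique = [] ; eq = G≡1 }
  ... | inj₂ 1≤G with primeDivisorM G 1≤G (<-wellFounded (deg G))
  ...   | P , pP , P∣G with pullOut P pP G (<-wellFounded (deg G))
  ...     | zero , H , refl , P∤H = contradiction (subst (P ∣M_) (*M-identityˡ H) P∣G) P∤H
  ...     | suc v , H , refl , P∤H with factoriseM H (rec (m<n+m (deg H) (≤-trans (proj₁ pP) (m≤m+n (deg P) (deg (powM P v))))))
  ...       | record { factors = fs ; primes = prs ; unique = u ; eq = refl } = record
    { factors = (P , suc v) ∷ fs
    ; primes  = (pP , s≤s z≤n) ∷ prs
    ; unique  = All.tabulate (λ { R∈ refl → P∤H (∈⇒prime∣product fs prs R∈) }) ∷ u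
    ; eq      = refl }

  -- Divisors and the formula for σ

  divisors : Monic → List Monic
  divisors G = filterᵇ (λ D → divB D G) (monicsUpTo (deg G))

  divisors-unique : ∀ G → Unique (divisors G)
  divisors-unique G = Unique.filter⁺ (T? ∘ λ D → divB D G) (monicsUpTo-unique (deg G))

  ∈-divisors⁺ : ∀ {D} G → D ∣M G → D ∈ divisors G
  ∈-divisors⁺ {D} G h = ∈-filter⁺ (T? ∘ λ D → divB D G) (monicsUpTo-complete {D} (∣M⇒deg≤ D G h)) (∣⇒divB D G h)

  ∈-divisors⁻ : ∀ {D} G → D ∈ divisors G → D ∣M G
  ∈-divisors⁻ {D} G h = divB⇒∣ D G (proj₂ (∈-filter⁻ (T? ∘ λ D → divB D G) {xs = monicsUpTo (deg G)} h))

  -- In D X = P^(k + 1) H the prime P must divide X, so one P can be cancelled from both sides.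
  ∣-coprimePart : ∀ P → IsPrime P → ∀ k D H → ¬ P ∣M D → D ∣M (powM P k *M H) → D ∣M H
  ∣-coprimePart P pP zero D H P∤D d = subst (D ∣M_) (*M-identityˡ H) d
  ∣-coprimePart P pP (suc k) D H P∤D (X , eq)
    with euclid pP D X (subst (P ∣M_) (trans (sym (*M-assoc P (powM P k) H)) (sym eq)) (powM P k *M H , refl))
  ... | inj₁ P∣D = contradiction P∣D P∤D
  ... | inj₂ (Y , refl) = ∣-coprimePart P pP k D H P∤D (Y , *M-cancelˡ P (begin
      P *M (D *M Y)         ≡⟨ *M-assoc P D Y ⟨
      (P *M D) *M Y         ≡⟨ cong (_*M Y) (*M-comm P D) ⟩
      (D *M P) *M Y         ≡⟨ *M-assoc D P Y ⟩
      D *M (P *M Y)         ≡⟨ eq ⟩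
      (P *M powM P k) *M H  ≡⟨ *M-assoc P (powM P k) H ⟩
      P *M (powM P k *M H)  ∎))
    where open ≡-Reasoning

  -- The divisors of P K are those prime to P, which divide H, and P times the divisors of K.
  divisors-↭ : ∀ P → IsPrime P → ∀ v H → ¬ P ∣M H →
               divisors (powM P (suc v) *M H) ↭ divisors H ++ map (P *M_) (divisors (powM P v *M H))
  divisors-↭ P pP v H P∤H = unique-⊆⇒↭ (divisors-unique G)
    (Unique.++⁺ (divisors-unique H) (Unique.map⁺ (*M-cancelˡ P) (divisors-unique K)) disjoint) to from
    where
    G = powM P (suc v) *M H
    K = powM P v *M H
    PK≡G : P *M K ≡ G
    PK≡G = sym (*M-assoc P (powM P v) H)
    disjoint : ∀ {D} → ¬ (D ∈ divisors H × D ∈ map (P *M_) (divisors K))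
    disjoint (D∈ , D∈′) with ∈-map⁻ (P *M_) D∈′
    ... | E , _ , refl = P∤H (∣M-trans P (P *M E) H (E , refl) (∈-divisors⁻ H D∈))
    to : ∀ {D} → D ∈ divisors G → D ∈ divisors H ++ map (P *M_) (divisors K)
    to {D} D∈ with P ∣M? D
    ... | no P∤D = ∈-++⁺ˡ (∈-divisors⁺ H (∣-coprimePart P pP (suc v) D H P∤D (∈-divisors⁻ G D∈)))
    ... | yes (E , refl) with ∈-divisors⁻ {P *M E} G D∈
    ...   | X , eq = ∈-++⁺ʳ (divisors H) (∈-map⁺ (P *M_) (∈-divisors⁺ K
              (X , *M-cancelˡ P (trans (sym (*M-assoc P E X)) (trans eq (sym PK≡G))))))
    from : ∀ {D} → D ∈ divisors H ++ map (P *M_) (divisors K) → D ∈ divisors G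
    from {D} D∈ with ∈-++⁻ (divisors H) D∈
    ... | inj₁ h = ∈-divisors⁺ G (∣M-*ˡ D H (powM P (suc v)) (∈-divisors⁻ H h))
    ... | inj₂ h with ∈-map⁻ (P *M_) h
    ...   | E , E∈ , refl with ∈-divisors⁻ {E} K E∈
    ...     | X , eq = ∈-divisors⁺ G (X , trans (*M-assoc P E X) (trans (cong (P *M_) eq) PK≡G))

  ∣∣-* : ∀ A B → ∣ A *M B ∣ ≡ ∣ A ∣ * ∣ B ∣
  ∣∣-* A B = ^-distribˡ-+-* q (deg A) (deg B)

  σ-step : ∀ P → IsPrime P → ∀ v H → ¬ P ∣M H → σ (powM P (suc v) *M H) ≡ σ H + ∣ P ∣ * σ (powM P v *M H)
  σ-step P pP v H P∤H = begin
    sum (map ∣_∣ (divisors (powM P (suc v) *M H)))                   ≡⟨ sum-↭ (map⁺ ∣_∣ (divisors-↭ P pP v H P∤H)) ⟩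
    sum (map ∣_∣ (divisors H ++ map (P *M_) (divisors K)))           ≡⟨ cong sum (map-++ ∣_∣ (divisors H) _) ⟩
    sum (map ∣_∣ (divisors H) ++ map ∣_∣ (map (P *M_) (divisors K))) ≡⟨ sum-++ (map ∣_∣ (divisors H)) _ ⟩
    σ H + sum (map ∣_∣ (map (P *M_) (divisors K)))                   ≡⟨ cong (σ H +_) (sum-scaled (divisors K)) ⟩
    σ H + ∣ P ∣ * σ K                                                ∎
    where
    open ≡-Reasoning
    K = powM P v *M H
    sum-scaled : ∀ Ds → sum (map ∣_∣ (map (P *M_) Ds)) ≡ ∣ P ∣ * sum (map ∣_∣ Ds)
    sum-scaled [] = sym (*-zeroʳ ∣ P ∣)
    sum-scaled (D ∷ Ds) = trans (cong₂ _+_ (∣∣-* P D) (sum-scaled Ds)) (sym (*-distribˡ-+ ∣ P ∣ ∣ D ∣ _))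

  -- The recursion in `σ-step` is that of `geo`. This is all the multiplicativity of σ that the
  -- prime factorisation calls for.
  σ-primePower : ∀ P → IsPrime P → ∀ v H → ¬ P ∣M H → σ (powM P v *M H) ≡ geo ∣ P ∣ (suc v) * σ H
  σ-primePower P pP zero H P∤H = trans (cong σ (*M-identityˡ H))
    (trans (sym (*-identityˡ (σ H))) (cong (_* σ H) (cong suc (sym (*-zeroʳ ∣ P ∣)))))
  σ-primePower P pP (suc v) H P∤H = trans (σ-step P pP v H P∤H)
    (trans (cong (λ s → σ H + ∣ P ∣ * s) (σ-primePower P pP v H P∤H)) (cong (σ H +_) (sym (*-assoc ∣ P ∣ _ (σ H)))))

  σ-one : σ oneM ≡ 1
  σ-one = trans (sum-↭ (map⁺ ∣_∣ (unique-⊆⇒↭ {xs = divisors oneM} {ys = oneM ∷ []} (divisors-unique oneM) ([] ∷ [])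
    (λ {D} D∈ → here (∣M-one D (∈-divisors⁻ oneM D∈))) λ { (here refl) → ∈-divisors⁺ oneM (∣M-refl oneM) }))) refl

  predNorm : Monic → ℕ
  predNorm P = ∣ P ∣ ∸ 1

  topNorm : Monic × ℕ → ℕ
  topNorm (P , v) = q ^ (deg P * suc v) ∸ 1

  1≤∣∣ : ∀ A → 1 ≤ ∣ A ∣
  1≤∣∣ A = m^n>0 q (deg A)

  -- The denominators of the geometric sums are kept on the left, which is already the shape of the
  -- equation from which the chains are built.
  σ-formula : ∀ fs → All (λ f → IsPrime (proj₁ f) × 1 ≤ proj₂ f) fs → Unique (map proj₁ fs) →
              σ (prodM (map powersOf fs)) * product (map (predNorm ∘ proj₁) fs) ≡ product (map topNorm fs)
  σ-formula [] [] [] = trans (*-identityʳ (σ oneM)) σ-one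
  σ-formula ((P , v) ∷ fs) ((pP , _) ∷ prs) (P∉ ∷ u) = begin
    σ (powM P v *M H) * (predNorm P * X)       ≡⟨ cong (_* (predNorm P * X)) (σ-primePower P pP v H P∤H) ⟩
    g * σ H * (predNorm P * X) ≡⟨ rearrange g (σ H) (predNorm P) X ⟩
    predNorm P * g * (σ H * X) ≡⟨ cong₂ _*_ (trans (sym (^-geo-∸ ∣ P ∣ (suc v) (1≤∣∣ P))) (cong (_∸ 1) (^-*-assoc q (deg P) (suc v)))) (σ-formula fs prs u) ⟩
    topNorm (P , v) * product (map topNorm fs) ∎
    where
    open ≡-Reasoning
    g = geo ∣ P ∣ (suc v)
    H = prodM (map powersOf fs)
    X = product (map (predNorm ∘ proj₁) fs)
    P∤H : ¬ P ∣M H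
    P∤H d = All.lookup P∉ (prime∣product⇒∈ pP fs prs d) refl
    rearrange : ∀ g s p x → g * s * (p * x) ≡ p * g * (s * x)
    rearrange = solve-∀

-- Assembling the chains

card-prime : ∀ Q → Prime (card Q)
card-prime q2 = from-yes (prime? 2)
card-prime q3 = from-yes (prime? 3)

prime-∣-product : ∀ {z} → Prime z → ∀ ns → z ∣ product ns → ∃ λ n → n ∈ ns × z ∣ n
prime-∣-product pz [] d = contradiction d (prime∤1 pz)
prime-∣-product pz (n ∷ ns) d with euclidsLemma n (product ns) pz d
... | inj₁ h = n , here refl , h
... | inj₂ h with prime-∣-product pz ns h
...   | m , m∈ , z∣m = m , there m∈ , z∣m

prime-∣-product-map : ∀ {A : Set} {z} (f : A → ℕ) → Prime z → ∀ xs → z ∣ product (map f xs) → ∃ λ x → x ∈ xs × z ∣ f x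
prime-∣-product-map f pz xs d with prime-∣-product pz (map f xs) d
... | n , n∈ , h with ∈-map⁻ f n∈
...   | x , x∈ , refl = x , x∈ , h

∈⇒∣product-map : ∀ {A : Set} (f : A → ℕ) {x xs} → x ∈ xs → f x ∣ product (map f xs)
∈⇒∣product-map f x∈ = ∈⇒∣product (∈-map⁺ f x∈)

max-split : ∀ {A : Set} (f : A → ℕ) x xs → ∃₂ λ y ys → x ∷ xs ↭ y ∷ ys × All (λ z → f z ≤ f y) ys
max-split f x [] = x , [] , ↭-refl , []
max-split f x (x′ ∷ xs) with max-split f x′ xs
... | y , ys , p , all with f x ≤? f y
...   | yes x≤y = y , x ∷ ys , ↭-trans (↭-prep x p) (Perm.swap x y ↭-refl) , x≤y ∷ all
...   | no x≰y = x , y ∷ ys , ↭-prep x p , <⇒≤ (≰⇒> x≰y) ∷ All.map (λ h → ≤-trans h (<⇒≤ (≰⇒> x≰y))) all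

unique-++⁻ : ∀ {A : Set} (xs : List A) {ys} → Unique (xs ++ ys) → Unique xs × Unique ys × (∀ {z} → z ∈ xs → ¬ z ∈ ys)
unique-++⁻ [] u = [] , u , λ ()
unique-++⁻ (x ∷ xs) (x∉ ∷ u) with unique-++⁻ xs u
... | u₁ , u₂ , dis = All.++⁻ˡ xs x∉ ∷ u₁ , u₂ , λ
  { (here refl) z∈ → All.lookup (All.++⁻ʳ xs x∉) z∈ refl
  ; (there z∈xs) z∈ → dis z∈xs z∈ }

module Decomposition (Q : Qs) where
  open Poly Q
  open PolyRing Q
  open Factorisation Q

  private
    2≤q = 2≤card Q

  units : ℕ → ℕ
  units n = q ^ n ∸ 1

  IsPrimePower : Monic × ℕ → Set
  IsPrimePower g = IsPrime (proj₁ g) × 1 ≤ proj₂ g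

  topDeg : Monic × ℕ → ℕ
  topDeg (P , v) = deg P * suc v

  1≤topDeg : ∀ {g} → IsPrimePower g → 1 ≤ topDeg g
  1≤topDeg (pP , _) = *-mono-≤ (proj₁ pP) (s≤s z≤n)

  -- As q is prime, it would divide a factor q^t - 1 on the right of `σ-formula`.
  q∤σ : ∀ {G} → PrimePowers G → ¬ q ∣ σ G
  q∤σ record { factors = fs ; primes = prs ; unique = u ; eq = refl } d
    with prime-∣-product-map topNorm (card-prime Q) fs
           (subst (q ∣_) (σ-formula fs prs u) (∣m⇒∣m*n _ d))
  ... | g , g∈ , h = prime∣q^∸1⇒∤q q 2≤q (card-prime Q) (topDeg g) (1≤topDeg (All.lookup prs g∈)) h ∣-refl

  primesOf : Monic → List Monic
  primesOf G = filterᵇ (λ P → primeB P ∧ divB P G) (monicsUpTo (deg G))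

  ∈-primesOf⁺ : ∀ {P} G → IsPrime P → P ∣M G → P ∈ primesOf G
  ∈-primesOf⁺ {P} G pP d = ∈-filter⁺ (T? ∘ λ P → primeB P ∧ divB P G) (monicsUpTo-complete {P} (∣M⇒deg≤ P G d))
    (Equivalence.from (T-∧ {primeB P}) (prime⇒primeB P pP , ∣⇒divB P G d))

  ∈-primesOf⁻ : ∀ {P} G → P ∈ primesOf G → IsPrime P × P ∣M G
  ∈-primesOf⁻ {P} G P∈ with Equivalence.to (T-∧ {primeB P}) (proj₂ (∈-filter⁻ (T? ∘ λ P → primeB P ∧ divB P G) {xs = monicsUpTo (deg G)} P∈))
  ... | a , b = primeB⇒prime P a , divB⇒∣ P G b

  primesOf-unique : ∀ G → Unique (primesOf G)
  primesOf-unique G = Unique.filter⁺ (T? ∘ λ P → primeB P ∧ divB P G) (monicsUpTo-unique (deg G))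

  -- `val` counts the exponents k with P^k ∣ G, and both 1 and 2 are among those counted.
  square∣⇒2≤val : ∀ P G → IsPrime P → powM P 2 ∣M G → 2 ≤ val P G
  square∣⇒2≤val P G pP d = unique-⊆⇒length≤ {xs = 1 ∷ 2 ∷ []} (((λ ()) ∷ []) ∷ [] ∷ []) ⊆
    where
    2≤G : 2 ≤ deg G
    2≤G = ≤-trans (+-mono-≤ (proj₁ pP) (≤-trans (proj₁ pP) (m≤m+n (deg P) 0))) (∣M⇒deg≤ (powM P 2) G d)
    keep : ∀ {k} → suc k ≤ deg G → powM P (suc k) ∣M G → suc k ∈ filterᵇ (λ k → divB (powM P k) G) (map suc (upTo (deg G)))
    keep {k} k<G h = ∈-filter⁺ (T? ∘ λ k → divB (powM P k) G) (∈-map⁺ suc (∈-upTo⁺ k<G)) (∣⇒divB (powM P (suc k)) G h)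
    ⊆ : ∀ {k} → k ∈ 1 ∷ 2 ∷ [] → k ∈ filterᵇ (λ k → divB (powM P k) G) (map suc (upTo (deg G)))
    ⊆ (here refl) = keep (<⇒≤ 2≤G) (∣M-trans (powM P 1) (powM P 2) G (subst (_∣M powM P 2) (sym (*M-identityʳ P)) (powM P 1 , refl)) d)
    ⊆ (there (here refl)) = keep 2≤G d

  φ-factor : Monic → Monic → ℕ
  φ-factor G P = ∣ P ∣ ^ (val P G ∸ 1) * (∣ P ∣ ∸ 1)

  q∤φ⇒val : ∀ G → ¬ q ∣ φ G → ∀ {P} → P ∈ primesOf G → val P G ∸ 1 ≡ 0
  q∤φ⇒val G q∤ {P} P∈ = n≢1+⇒0 (val P G ∸ 1) λ k eq → q∤ (∣-trans
      (∣m⇒∣m*n (∣ P ∣ ∸ 1) (subst (λ e → q ∣ ∣ P ∣ ^ e) (sym eq) (∣m⇒∣m*n (∣ P ∣ ^ k) q∣P)))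
      (∈⇒∣product-map (φ-factor G) P∈))
    where
    n≢1+⇒0 : ∀ n → (∀ k → n ≡ suc k → ⊥) → n ≡ 0
    n≢1+⇒0 zero _ = refl
    n≢1+⇒0 (suc k) h = ⊥-elim (h k refl)
    q∣q^ : ∀ n → 1 ≤ n → q ∣ q ^ n
    q∣q^ (suc n) _ = m∣m*n (q ^ n)
    q∣P : q ∣ ∣ P ∣
    q∣P = q∣q^ (deg P) (proj₁ (proj₁ (∈-primesOf⁻ G P∈)))

  -- A repeated prime P would contribute to φ a positive power of the norm of P, which is divisible
  -- by q.
  φ-squarefree : ∀ G → ¬ q ∣ φ G →
                 ∃ λ Ps → All IsPrime Ps × Unique Ps × G ≡ prodM Ps × φ G ≡ product (map predNorm Ps)
  φ-squarefree G q∤ with factoriseM G (<-wellFounded (deg G))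
  ... | record { factors = fs ; primes = prs ; unique = u ; eq = G≡ } =
    map proj₁ fs , All.map⁺ (All.map proj₁ prs) , u , trans G≡ (cong prodM (simple fs prs exponents)) , φ≡
    where
    divides-G : ∀ {P} → P ∈ map proj₁ fs → P ∣M G
    divides-G {P} P∈ = subst (P ∣M_) (sym G≡) (∈⇒prime∣product fs prs P∈)
    primesOf↭ : primesOf G ↭ map proj₁ fs
    primesOf↭ = unique-⊆⇒↭ (primesOf-unique G) u
      (λ {P} P∈ → prime∣product⇒∈ (proj₁ (∈-primesOf⁻ G P∈)) fs prs (subst (P ∣M_) G≡ (proj₂ (∈-primesOf⁻ G P∈))))
      (λ P∈ → ∈-primesOf⁺ G (All.lookup (All.map⁺ (All.map proj₁ prs)) P∈) (divides-G P∈))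
    exponents : ∀ {g} → g ∈ fs → proj₂ g ≤ 1
    exponents {P , zero} g∈ = z≤n
    exponents {P , suc zero} g∈ = ≤-refl
    exponents {P , suc (suc v)} g∈ = contradiction
      (subst (1 ≤_) (q∤φ⇒val G q∤ (∈-primesOf⁺ G pP (divides-G (∈-map⁺ proj₁ g∈))))
        (∸-monoˡ-≤ 1 (square∣⇒2≤val P G pP P²∣G))) λ ()
      where
      pP = proj₁ (All.lookup prs g∈)
      P²∣G : powM P 2 ∣M G
      P²∣G = subst (powM P 2 ∣M_) (sym G≡) (∣M-trans (powM P 2) (powM P (suc (suc v))) _
        (powM P v , trans (*M-assoc P (powM P 1) (powM P v)) (cong (λ R → P *M (R *M powM P v)) (*M-identityʳ P)))
        (factor∣product (map powersOf fs) (∈-map⁺ powersOf g∈)))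
    simple : ∀ fs → All IsPrimePower fs → (∀ {g} → g ∈ fs → proj₂ g ≤ 1) → map powersOf fs ≡ map proj₁ fs
    simple [] [] _ = refl
    simple ((P , v) ∷ fs) ((_ , 1≤v) ∷ prs) h with ≤-antisym (h (here refl)) 1≤v
    ... | refl = cong₂ _∷_ (*M-identityʳ P) (simple fs prs (h ∘ there))
    drop-powers : ∀ Ps → (∀ {P} → P ∈ Ps → val P G ∸ 1 ≡ 0) → map (φ-factor G) Ps ≡ map predNorm Ps
    drop-powers [] _ = refl
    drop-powers (P ∷ Ps) h = cong₂ _∷_
      (trans (cong (λ e → ∣ P ∣ ^ e * (∣ P ∣ ∸ 1)) (h (here refl))) (*-identityˡ _)) (drop-powers Ps (h ∘ there))
    φ≡ : φ G ≡ product (map predNorm (map proj₁ fs))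
    φ≡ = trans (cong product (drop-powers (primesOf G) (q∤φ⇒val G q∤))) (product-↭ (map⁺ predNorm primesOf↭))

  -- The data of an element of V, with `end` as F and the product of the `links` as G. That `start`
  -- divides `dq Q` is left out, for it holds only once the construction is complete.
  record Chain : Set where
    field
      start  : ℕ
      links  : List (Monic × ℕ)
      end    : Monic
      start-positive : 1 ≤ start
      links-positive : All (0 <_) (map proj₂ links)
      degrees : Pointwise (λ P d → IsPrime P × deg P ≡ d) (map proj₁ links ++ [ end ]) (degs start (map proj₂ links))
  open Chain

  prime-chain : ∀ P → IsPrime P → Chain
  prime-chain P pP = record
    { start = deg P ; links = [] ; end = P ; start-positive = proj₁ pP ; links-positive = [] ; degrees = (pP , refl) ∷ [] }

  prime-chains : ∀ Ps → All IsPrime Ps →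
                 ∃ λ cs → map end cs ≡ Ps × concatMap links cs ≡ [] × product (map (units ∘ start) cs) ≡ product (map predNorm Ps)
  prime-chains [] [] = [] , refl , refl , refl
  prime-chains (P ∷ Ps) (pP ∷ pPs) with prime-chains Ps pPs
  ... | cs , e , l , s = prime-chain P pP ∷ cs , cong (P ∷_) e , l , cong (predNorm P *_) s

  -- The old start is deg P · (v + 1), exactly the degree that `degs` prescribes after a first link
  -- P^v.
  prepend : ∀ g → IsPrimePower g → (c : Chain) → start c ≡ topDeg g → Chain
  prepend (P , v) (pP , 1≤v) c eq = record
    { start = deg P ; links = (P , v) ∷ links c ; end = end c
    ; start-positive = proj₁ pP ; links-positive = 1≤v ∷ links-positive c
    ; degrees = (pP , refl) ∷ subst (λ s → Pointwise _ _ (degs s (map proj₂ (links c))))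
                                (trans eq (cong (deg P *_) (+-comm 1 v))) (degrees c) }

  private
    d = dq Q

    primitive-∣ : ∀ {t z} → IsOrder q 2≤q z t → ∀ {n} → z ∣ units n → t ∣ n
    primitive-∣ ord {n} h = order-∣ q 2≤q ord n h

    -- ds₁ and ds₂ record the degrees and top degrees of the prime powers already discarded.
    Balanced : List Chain → List (Monic × ℕ) → List ℕ → List ℕ → Set
    Balanced cs gs ds₁ ds₂ =
      product (map (units ∘ start) cs) * product (map (units ∘ deg ∘ proj₁) gs) * product (map units ds₁)
        ≡ product (map (units ∘ topDeg) gs) * product (map units ds₂)

  -- Both `ends` and `partition` are permutations: this preserves the products, and also the
  -- distinctness of the primes, from which coprimality is later obtained.
  record Result (cs : List Chain) (gs : List (Monic × ℕ)) : Set where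
    field
      chains    : List Chain
      rest      : List (Monic × ℕ)
      starts    : All (λ c → start c ∣ d) chains
      rest-∣    : All (λ g → topDeg g ∣ d) rest
      ends      : map end chains ↭ map end cs
      partition : rest ++ concatMap links chains ↭ gs ++ concatMap links cs

  -- With no prime powers left, the right side has only factors q^n - 1 with n ∣ d, and a primitive
  -- prime of another start could not divide it.
  balanced-start-∣ : ∀ {cs ds₁ ds₂} → Balanced cs [] ds₁ ds₂ → All (_∣ d) ds₂ → All (λ c → start c ∣ d) cs
  balanced-start-∣ {cs} {ds₁} {ds₂} bal ∣d₂ = All.tabulate λ {c} c∈ → go c c∈
    where
    go : ∀ c → c ∈ cs → start c ∣ d
    go c c∈ with start c ∣? d
    ... | yes h = h
    ... | no ∤d with zsigmondy Q (start c) (start-positive c) ∤d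
    ...   | z , pz , ord with prime-∣-product-map units pz ds₂ (subst (z ∣_) (*-identityˡ (product (map units ds₂)))
              (subst (z ∣_) bal (∣m⇒∣m*n _ (∣m⇒∣m*n 1 (∣-trans (proj₁ (proj₂ ord)) (∈⇒∣product-map (units ∘ start) c∈))))))
    ...     | n , n∈ , h = ∣-trans (primitive-∣ ord h) (All.lookup ∣d₂ n∈)

  -- A primitive prime for t = `topDeg g` divides the left side. It cannot come from the discarded
  -- degrees, which divide d, nor from a remaining degree, which is smaller than its own top degree
  -- and so than t. Only the starts are left.
  find-chain : ∀ {cs g gs ds₁ ds₂} → Balanced cs (g ∷ gs) ds₁ ds₂ → All IsPrimePower (g ∷ gs) →
               All (_∣ d) ds₁ → All (_∣ d) ds₂ → All (λ h → topDeg h ≤ topDeg g) gs → ¬ topDeg g ∣ d →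
               ∃ λ c → c ∈ cs × start c ≡ topDeg g
  find-chain {cs} {g} {gs} {ds₁} {ds₂} bal ok ∣d₁ ∣d₂ max t∤d with zsigmondy Q (topDeg g) (1≤topDeg (All.head ok)) t∤d
  ... | z , pz , ord with euclidsLemma (C * Γ) D₁ pz
          (subst (z ∣_) (sym bal) (∣m⇒∣m*n D₂ (∣m⇒∣m*n _ (proj₁ (proj₂ ord)))))
    where
    C = product (map (units ∘ start) cs)
    Γ = product (map (units ∘ deg ∘ proj₁) (g ∷ gs))
    D₁ = product (map units ds₁)
    D₂ = product (map units ds₂)
  ... | inj₂ z∣D₁ with prime-∣-product-map units pz ds₁ z∣D₁
  ...   | n , n∈ , h = contradiction (∣-trans (primitive-∣ ord h) (All.lookup ∣d₁ n∈)) t∤d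
  find-chain {cs} {g} {gs} {ds₁} {ds₂} bal ok ∣d₁ ∣d₂ max t∤d | z , pz , ord | inj₁ z∣CΓ
    with euclidsLemma (product (map (units ∘ start) cs)) _ pz z∣CΓ
  ... | inj₂ z∣Γ with prime-∣-product-map (units ∘ deg ∘ proj₁) pz (g ∷ gs) z∣Γ
  ...   | h , h∈ , z∣h = contradiction (∣⇒≤ {{>-nonZero 1≤P}} (primitive-∣ ord z∣h)) (<⇒≱ (<-≤-trans P<top top≤))
    where
    1≤P = proj₁ (proj₁ (All.lookup ok h∈))
    P<top : deg (proj₁ h) < topDeg h
    P<top = m<m*n (deg (proj₁ h)) (suc (proj₂ h)) {{>-nonZero 1≤P}} (s≤s (proj₂ (All.lookup ok h∈)))
    top≤ : topDeg h ≤ topDeg g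
    top≤ = All.lookup (≤-refl ∷ max) h∈
  find-chain {cs} {g} {gs} {ds₁} {ds₂} bal ok ∣d₁ ∣d₂ max t∤d | z , pz , ord | inj₁ z∣CΓ | inj₁ z∣C
    with prime-∣-product-map (units ∘ start) pz cs z∣C
  ... | c , c∈ , z∣c = c , c∈ , ≤-antisym start≤ (∣⇒≤ {{>-nonZero (start-positive c)}} t∣start)
    where
    t∣start : topDeg g ∣ start c
    t∣start = primitive-∣ ord z∣c
    start∤d : ¬ start c ∣ d
    start∤d h = t∤d (∣-trans t∣start h)
    -- So far t ∣ `start c`. A primitive prime for `start c` divides the right side, so `start c`
    -- divides some remaining top degree, and none exceeds t.
    start≤ : start c ≤ topDeg g
    start≤ with zsigmondy Q (start c) (start-positive c) start∤d
    ... | y , py , ord′ with euclidsLemma (product (map (units ∘ topDeg) (g ∷ gs))) _ py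
            (subst (y ∣_) bal (∣m⇒∣m*n _ (∣m⇒∣m*n _ (∣-trans (proj₁ (proj₂ ord′)) (∈⇒∣product-map (units ∘ start) c∈)))))
    ... | inj₁ h with prime-∣-product-map (units ∘ topDeg) py (g ∷ gs) h
    ...   | g′ , g′∈ , y∣ = ≤-trans (∣⇒≤ {{>-nonZero (1≤topDeg (All.lookup ok g′∈))}} (primitive-∣ ord′ y∣)) (All.lookup (≤-refl ∷ max) g′∈)
    start≤ | y , py , ord′ | inj₂ h with prime-∣-product-map units py ds₂ h
    ...   | n , n∈ , y∣ = contradiction (∣-trans (primitive-∣ ord′ y∣) (All.lookup ∣d₂ n∈)) start∤d

  balanced-↭ : ∀ {cs cs′ gs gs′ ds₁ ds₂} → cs ↭ cs′ → gs ↭ gs′ → Balanced cs gs ds₁ ds₂ → Balanced cs′ gs′ ds₁ ds₂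
  balanced-↭ {ds₁ = ds₁} {ds₂} p r bal = subst₂ _≡_
    (cong (_* product (map units ds₁)) (cong₂ _*_ (product-↭ (map⁺ (units ∘ start) p)) (product-↭ (map⁺ (units ∘ deg ∘ proj₁) r))))
    (cong (_* product (map units ds₂)) (product-↭ (map⁺ (units ∘ topDeg) r))) bal

  concatMap-↭ : ∀ {cs cs′} → cs ↭ cs′ → concatMap links cs ↭ concatMap links cs′
  concatMap-↭ Perm.refl = ↭-refl
  concatMap-↭ (Perm.prep c p) = ++⁺ˡ (links c) (concatMap-↭ p)
  concatMap-↭ (Perm.swap {cs} {cs′} c c′ p) = ↭-trans (shifts (links c) (links c′)) (++⁺ˡ (links c′) (++⁺ˡ (links c) (concatMap-↭ p)))
  concatMap-↭ (Perm.trans p r) = ↭-trans (concatMap-↭ p) (concatMap-↭ r)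

  -- The length k carries the recursion, since `max-split` permutes the list and its remainder is no
  -- subterm.
  build : ∀ k cs gs ds₁ ds₂ → length gs ≡ k → All IsPrimePower gs → All (_∣ d) ds₁ → All (_∣ d) ds₂ →
          Balanced cs gs ds₁ ds₂ → Result cs gs
  build _ cs [] ds₁ ds₂ _ _ _ ∣d₂ bal = record
    { chains = cs ; rest = [] ; starts = balanced-start-∣ {cs} {ds₁} {ds₂} bal ∣d₂ ; rest-∣ = [] ; ends = ↭-refl ; partition = ↭-refl }
  build (suc k) cs (g₀ ∷ gs₀) ds₁ ds₂ len ok ∣d₁ ∣d₂ bal with max-split topDeg g₀ gs₀
  ... | g , gs , p , max with topDeg g ∣? d
  ... | yes t∣d = record
    { chains = chains ; rest = g ∷ rest ; starts = starts ; rest-∣ = t∣d ∷ rest-∣ ; ends = ends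
    ; partition = ↭-trans (↭-prep g partition) (++⁺ʳ (concatMap links cs) (↭-sym p)) }
    where
    -- Both factors of g stay in the equation and only change lists; deg P divides t and hence also
    -- d.
    bal′ : Balanced cs gs (deg (proj₁ g) ∷ ds₁) (topDeg g ∷ ds₂)
    bal′ = trans (left (product (map (units ∘ start) cs)) _ (units (deg (proj₁ g))) _) (trans (balanced-↭ {cs} {cs} {ds₁ = ds₁} {ds₂} ↭-refl p bal) (right (units (topDeg g)) _ _))
      where
      left : ∀ a b c e → a * b * (c * e) ≡ a * (c * b) * e
      left = solve-∀
      right : ∀ a b c → a * b * c ≡ b * (a * c)
      right = solve-∀
    ok′ = All-resp-↭ p ok
    open Result (build k cs gs (deg (proj₁ g) ∷ ds₁) (topDeg g ∷ ds₂) (suc-injective (trans (sym (↭-length p)) len))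
      (All.tail ok′) (∣-trans (m∣m*n (suc (proj₂ g))) t∣d ∷ ∣d₁) (t∣d ∷ ∣d₂) bal′)
  ... | no t∤d = record
    { chains = chains ; rest = rest ; starts = starts ; rest-∣ = rest-∣
    ; ends = ↭-trans ends (↭-sym (map⁺ end p′))
    ; partition = ↭-trans partition (↭-trans (shift g gs (links c ++ concatMap links cs′))
        (↭-trans (++⁺ˡ (g ∷ gs) (↭-sym (concatMap-↭ p′))) (++⁺ʳ (concatMap links cs) (↭-sym p)))) }
    where
    ok′ = All-resp-↭ p ok
    bal₁ : Balanced cs (g ∷ gs) ds₁ ds₂
    bal₁ = balanced-↭ {cs} {cs} {ds₁ = ds₁} {ds₂} ↭-refl p bal
    found = find-chain {cs} {g} {gs} {ds₁} {ds₂} bal₁ ok′ ∣d₁ ∣d₂ max t∤d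
    c = proj₁ found
    split = ∈⇒↭∷ (proj₁ (proj₂ found))
    cs′ = proj₁ split
    p′ = proj₂ split
    start≡ = proj₂ (proj₂ found)
    c′ = prepend g (All.head ok′) c start≡
    -- The start of c and the top degree of g both give q^t - 1, which cancels; q^deg P - 1 is now
    -- the factor of the start of `c′`.
    bal₂ : Balanced (c′ ∷ cs′) gs ds₁ ds₂
    bal₂ = *-cancelˡ-≡ _ _ (units (topDeg g)) {{>-nonZero (1≤q^∸1 q 2≤q (topDeg g) (1≤topDeg (All.head ok′)))}}
      (trans (left (units (topDeg g)) (units (deg (proj₁ g))) _ _ _)
      (trans (cong (λ s → units s * product (map (units ∘ start) cs′) * product (map (units ∘ deg ∘ proj₁) (g ∷ gs)) * product (map units ds₁)) (sym start≡))
      (trans (balanced-↭ {gs = g ∷ gs} {g ∷ gs} {ds₁} {ds₂} p′ ↭-refl bal₁) (*-assoc (units (topDeg g)) _ _))))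
      where
      left : ∀ t a x y e → t * (a * x * y * e) ≡ t * x * (a * y) * e
      left = solve-∀
    open Result (build k (c′ ∷ cs′) gs ds₁ ds₂ (suc-injective (trans (sym (↭-length p)) len)) (All.tail ok′) ∣d₁ ∣d₂ bal₂)

  -- Products over blocks, coprimality and the bounded remainder

  prodM-++ : ∀ As Bs → prodM (As ++ Bs) ≡ prodM As *M prodM Bs
  prodM-++ [] Bs = sym (*M-identityˡ (prodM Bs))
  prodM-++ (A ∷ As) Bs = trans (cong (A *M_) (prodM-++ As Bs)) (sym (*M-assoc A (prodM As) (prodM Bs)))

  prodM-↭ : ∀ {As Bs} → As ↭ Bs → prodM As ≡ prodM Bs
  prodM-↭ Perm.refl = refl
  prodM-↭ (Perm.prep A p) = cong (A *M_) (prodM-↭ p)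
  prodM-↭ (Perm.swap {As} {Bs} A B p) = trans (cong (λ X → A *M (B *M X)) (prodM-↭ p))
    (trans (sym (*M-assoc A B (prodM Bs))) (trans (cong (_*M prodM Bs) (*M-comm A B)) (*M-assoc B A (prodM Bs))))
  prodM-↭ (Perm.trans p r) = trans (prodM-↭ p) (prodM-↭ r)

  primePowerProduct : List (Monic × ℕ) → Monic
  primePowerProduct gs = prodM (map powersOf gs)

  primePowerProduct-concat : ∀ gss → primePowerProduct (concat gss) ≡ prodM (map primePowerProduct gss)
  primePowerProduct-concat [] = refl
  primePowerProduct-concat (gs ∷ gss) = trans (cong prodM (map-++ powersOf gs (concat gss)))
    (trans (prodM-++ (map powersOf gs) _) (cong (primePowerProduct gs *M_) (primePowerProduct-concat gss)))

  -- A prime dividing two of the products would be listed in two blocks, against uniqueness in the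
  -- concatenation.
  blocks-coprime : ∀ gss → All IsPrimePower (concat gss) → Unique (map proj₁ (concat gss)) →
                   AllPairs Coprime (map primePowerProduct gss)
  blocks-coprime [] _ _ = []
  blocks-coprime (gs ∷ gss) ok u
    with u₁ , u₂ , disjoint ← unique-++⁻ (map proj₁ gs) (subst Unique (map-++ proj₁ gs (concat gss)) u)
    = All.map⁺ (All.tabulate (λ {hs} hs∈ → coprime-by-primes (primePowerProduct gs) (primePowerProduct hs) λ P pP P∣gs P∣hs →
        disjoint (prime∣product⇒∈ pP gs (All.++⁻ˡ gs ok) P∣gs)
          (within hs∈ (prime∣product⇒∈ pP hs (All.tabulate (λ h∈ → All.lookup (All.++⁻ʳ gs ok) (∈-concat⁺′ h∈ hs∈))) P∣hs))))
      ∷ blocks-coprime gss (All.++⁻ʳ gs ok) u₂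
    where
    within : ∀ {hs P} → hs ∈ gss → P ∈ map proj₁ hs → P ∈ map proj₁ (concat gss)
    within hs∈ P∈ with ∈-map⁻ proj₁ P∈
    ... | h , h∈ , refl = ∈-map⁺ proj₁ (∈-concat⁺′ h∈ hs∈)

  primes-coprime : ∀ Ps → All IsPrime Ps → Unique Ps → AllPairs Coprime Ps
  primes-coprime [] [] [] = []
  primes-coprime (P ∷ Ps) (pP ∷ pPs) (P∉ ∷ u) =
    All.tabulate (λ {R} R∈ → coprime-by-primes P R λ S pS S∣P S∣R → All.lookup P∉ R∈
      (trans (sym (prime-∣-primeM pS pP S∣P)) (prime-∣-primeM pS (All.lookup pPs R∈) S∣R)))
    ∷ primes-coprime Ps pPs u

  one-coprime : ∀ A → Coprime oneM A
  one-coprime A D D∣1 _ = ∣M-one D D∣1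

  chain-InSomeV : ∀ c → start c ∣ d → InSomeV (end c) (primePowerProduct (links c))
  chain-InSomeV c h = start c , map proj₂ (links c) , h , start-positive c ∷ links-positive c ,
    map proj₁ (links c) , degrees c , cong prodM (zip (links c))
    where
    zip : ∀ gs → map powersOf gs ≡ zipWith powM (map proj₁ gs) (map proj₂ gs)
    zip [] = refl
    zip (g ∷ gs) = cong (powersOf g ∷_) (zip gs)

  deg-powM : ∀ P v → deg (powM P v) ≡ deg P * v
  deg-powM P zero = sym (*-zeroʳ (deg P))
  deg-powM P (suc v) = trans (cong (deg P +_) (deg-powM P v)) (sym (*-suc (deg P) v))

  private
    instance
      d≢0 : NonZero d
      d≢0 = dq-nonZero Q
        where
        dq-nonZero : ∀ Q → NonZero (dq Q)
        dq-nonZero q2 = _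
        dq-nonZero q3 = _

  -- The primes left over are distinct and have degree at most d, and each prime power P^v has
  -- degree at most (v + 1) deg P, which divides d.
  restBound : ℕ
  restBound = length (monicsUpTo d) * d

  rest-bounded : ∀ gs → All (λ g → topDeg g ∣ d) gs → Unique (map proj₁ gs) → deg (primePowerProduct gs) ≤ restBound
  rest-bounded gs h u = ≤-trans (by-length gs h)
    (*-monoˡ-≤ d (≤-trans (≤-reflexive (sym (length-map proj₁ gs))) (unique-⊆⇒length≤ u small)))
    where
    by-length : ∀ gs → All (λ g → topDeg g ∣ d) gs → deg (primePowerProduct gs) ≤ length gs * d
    by-length [] [] = z≤n
    by-length ((P , v) ∷ gs) (h ∷ hs) = +-mono-≤
      (≤-trans (≤-reflexive (deg-powM P v)) (≤-trans (*-monoʳ-≤ (deg P) (n≤1+n v)) (∣⇒≤ h))) (by-length gs hs)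
    small : ∀ {P} → P ∈ map proj₁ gs → P ∈ monicsUpTo d
    small P∈ with ∈-map⁻ proj₁ P∈
    ... | (P , v) , g∈ , refl = monicsUpTo-complete {P} (∣⇒≤ (∣-trans (m∣m*n (suc v)) (All.lookup h g∈)))

  -- The initial instance of `Balanced`, where nothing has been discarded; the factors 1 are the two
  -- empty products.
  norm-balance : ∀ {F G} Ps (fs : List (Monic × ℕ)) → All IsPrimePower fs → Unique (map proj₁ fs) → G ≡ primePowerProduct fs →
                 φ F ≡ product (map predNorm Ps) → φ F ≡ σ G →
                 product (map predNorm Ps) * product (map (units ∘ deg ∘ proj₁) fs) * 1 ≡ product (map (units ∘ topDeg) fs) * 1
  norm-balance {F} {G} Ps fs prs u refl φ≡ φ≡σ = cong (_* 1)
    (trans (cong (_* product (map (predNorm ∘ proj₁) fs)) (trans (sym φ≡) φ≡σ)) (σ-formula fs prs u))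

  exceptional : List (Monic × Monic)
  exceptional = map (oneM ,_) (monicsUpTo restBound)

  decompose : (F G : Monic) → φ F ≡ σ G →
    Σ Monic λ F₀ → Σ Monic λ G₀ → Σ (List (Monic × Monic)) λ ps →
    ((F₀ , G₀) ∈ exceptional) ×
    (F ≡ F₀ *M prodM (map proj₁ ps)) ×
    (G ≡ G₀ *M prodM (map proj₂ ps)) ×
    AllPairs Coprime (F₀ ∷ map proj₁ ps) ×
    AllPairs Coprime (G₀ ∷ map proj₂ ps) ×
    All (λ p → InSomeV (proj₁ p) (proj₂ p)) ps
  decompose F G φ≡σ with factoriseM G (<-wellFounded (deg G))
  ... | fac@record { factors = fs ; primes = prs ; unique = u ; eq = G≡ }
    with φ-squarefree F (λ h → q∤σ fac (subst (q ∣_) φ≡σ h))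
  ... | Ps , pPs , uPs , F≡ , φ≡ with prime-chains Ps pPs
  ... | cs , ends≡ , links≡ , starts≡
    with build (length fs) cs fs [] [] refl prs [] []
           (trans (cong (λ s → s * product (map (units ∘ deg ∘ proj₁) fs) * 1) starts≡) (norm-balance {F} Ps fs prs u G≡ φ≡ φ≡σ))
  ... | record { chains = cs′ ; rest = gs ; starts = starts ; rest-∣ = rest-∣ ; ends = ends ; partition = partition } =
    oneM , primePowerProduct gs , map pair cs′ ,
    ∈-map⁺ (oneM ,_) (monicsUpTo-complete {primePowerProduct gs} (rest-bounded gs rest-∣ unique-rest)) ,
    F-eq , G-eq ,
    (All.tabulate (λ {A} _ → one-coprime A) ∷ subst (AllPairs Coprime) fst≡ (primes-coprime (map end cs′) (All-resp-↭ (↭-sym ends↭) pPs) (unique-resp-↭ (↭-sym ends↭) uPs))) ,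
    subst (λ As → AllPairs Coprime (primePowerProduct gs ∷ As)) snd≡ (blocks-coprime blocks ok unique-blocks) ,
    All.map⁺ (All.map (λ {c} → chain-InSomeV c) starts)
    where
    pair : Chain → Monic × Monic
    pair c = end c , primePowerProduct (links c)
    blocks = gs ∷ map links cs′
    fst≡ : map end cs′ ≡ map proj₁ (map pair cs′)
    fst≡ = map-∘ cs′
    snd≡ : map primePowerProduct (map links cs′) ≡ map proj₂ (map pair cs′)
    snd≡ = trans (sym (map-∘ cs′)) (map-∘ cs′)
    ends↭ : map end cs′ ↭ Ps
    ends↭ = subst (map end cs′ ↭_) ends≡ ends
    fs↭ : fs ↭ concat blocks
    fs↭ = ↭-sym (subst (concat blocks ↭_) (trans (cong (fs ++_) links≡) (++-identityʳ fs)) partition)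
    ok : All IsPrimePower (concat blocks)
    ok = All-resp-↭ fs↭ prs
    unique-blocks : Unique (map proj₁ (concat blocks))
    unique-blocks = unique-resp-↭ (map⁺ proj₁ fs↭) u
    unique-rest : Unique (map proj₁ gs)
    unique-rest = proj₁ (unique-++⁻ (map proj₁ gs) (subst Unique (map-++ proj₁ gs (concat (map links cs′))) unique-blocks))
    F-eq : F ≡ oneM *M prodM (map proj₁ (map pair cs′))
    F-eq = trans F≡ (trans (prodM-↭ (↭-sym ends↭)) (trans (cong prodM fst≡) (sym (*M-identityˡ _))))
    G-eq : G ≡ primePowerProduct gs *M prodM (map proj₂ (map pair cs′))
    G-eq = trans G≡ (trans (prodM-↭ (map⁺ powersOf fs↭)) (trans (primePowerProduct-concat blocks)
      (cong (λ As → primePowerProduct gs *M prodM As) snd≡)))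

theorem1p3 : (Q : Qs) → let open Poly Q in
    Σ (List (Monic × Monic)) λ E →
    (F G : Monic) → φ F ≡ σ G →
    Σ Monic λ F₀ → Σ Monic λ G₀ → Σ (List (Monic × Monic)) λ ps →
    ((F₀ , G₀) ∈ E) ×
    (F ≡ F₀ *M prodM (map proj₁ ps)) ×
    (G ≡ G₀ *M prodM (map proj₂ ps)) ×
    AllPairs Coprime (F₀ ∷ map proj₁ ps) ×
    AllPairs Coprime (G₀ ∷ map proj₂ ps) ×
    All (λ p → InSomeV (proj₁ p) (proj₂ p)) ps
theorem1p3 Q = Decomposition.exceptional Q , Decomposition.decompose Q
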